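{- Let $\varepsilon,l,c\in\mathbb{R}$ satisfy $\varepsilon\in(0,1)$, $\max(\varepsilon,1-\varepsilon)<l<1$, $-l<c\le 0$, and suppose moreover that $\varepsilon\notin\mathbb{Q}$ and $l\notin\mathbb{Z}+\mathbb{Z}\varepsilon$. Let $u=(u_n)_{n\in\mathbb{N}}$ be the (non-degenerate) 3iet word with parameters $\varepsilon,l,c$. Let $\varphi$ be a primitive substitution over $\{A,B,C\}$ such that $\varphi(u)=u$. Then $\varepsilon$ is a Sturm number.
   Context: 3iet word: put $I_A=[c,c+\varepsilon+l-1)$, $I_B=[c+\varepsilon+l-1,c+\varepsilon)$, $I_C=[c+\varepsilon,c+l)$, $I=I_A\cup I_B\cup I_C$, and let $T:I\to I$ be the exchange of three intervals with permutation $(321)$: $T(x)=x+1-\varepsilon$ on $I_A$, $T(x)=x+1-2\varepsilon$ on $I_B$, $T(x)=x-\varepsilon$ on $I_C$. The 3iet word with parameters $\varepsilon,l,c$ is the infinite word $u=(u_n)_{n\in\mathbb{N}}$ over $\{A,B,C\}$ with $u_n=X$ if and only if $T^n(0)\in I_X$. (In terms of the lengths $\alpha,\beta,\gamma$ of $I_A,I_B,I_C$, normalized by $\alpha+2\beta+\gamma=1$, one has $\varepsilon=\alpha+\beta$ and $l=\alpha+\beta+\gamma$.) A substitution over $\mathcal{A}=\{A,B,C\}$ is a monoid morphism $\varphi:\mathcal{A}^*\to\mathcal{A}^*$ such that no letter has empty image; it acts on infinite words by $\varphi(u_0u_1\cdots)=\varphi(u_0)\varphi(u_1)\cdots$. Its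 incidence matrix is $(\boldsymbol{M}_\varphi)_{ij}=|\varphi(a_i)|_{a_j}$, the number of occurrences of $a_j$ in $\varphi(a_i)$, where $(a_1,a_2,a_3)=(A,B,C)$. It is primitive if some power $\boldsymbol{M}_\varphi^k$ has all entries positive. Sturm number: a quadratic irrational number $\varepsilon$ with algebraic conjugate $\varepsilon'$ such that $\varepsilon\in(0,1)$ and $\varepsilon'\notin(0,1)$. -}

module Defs where

open import Level using (0ℓ) renaming (suc to lsuc)
open import Algebra.Bundles using (CommutativeRing)
import Algebra.Definitions.RawMonoid as RawMonoidDefinitions
open import Algebra.Morphism.Structures using (module MonoidMorphisms)
open import Data.Bool.Base using (if_then_else_)
open import Data.Empty using (⊥-elim)
open import Data.Fin.Base using (Fin; zero; suc)
open import Data.Fin.Properties using (_≟_)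
open import Data.Integer.Base using (ℤ; +_; -[1+_])
open import Data.List.Base using (List; []; _∷_; [_]; length; filter; tabulate; ++-[]-rawMonoid)
open import Data.List.NonEmpty.Base using (List⁺; _∷_; head; tail)
open import Data.Nat.Base as ℕ using (ℕ; zero; suc)
open import Data.Nat.ListAction using (sum)
open import Data.Nat.GeneralisedArithmetic using (fold)
open import Data.Product.Base using (∃; ∃-syntax; _×_; _,_)
open import Function.Base using (_∘_)
open import Function.Bundles using (_⇔_)
open import Relation.Binary.Core using (Rel)
open import Relation.Binary.Structures using (IsStrictTotalOrder)
open import Relation.Binary.PropositionalEquality.Core using (_≡_; _≢_; refl)
open import Relation.Nullary.Decidable.Core using (does)
open import Relation.Nullary.Negation.Core using (¬_)
open import Relation.Unary using (Pred)

------------------------------------------------------------------------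
-- Real numbers

-- ℝ is given by its classical axioms, as a complete ordered field with
-- setoid equality.  The setting is classical as it stands: trichotomy
-- together with the ε-form of suprema gives excluded middle for every
-- Q : Set (compare sup {0} ∪ {1 ∣ Q} with a number strictly between 0
-- and 1), so no separate classical axiom is assumed.

record CompleteOrderedField : Set (lsuc 0ℓ) where
  field
    commutativeRing : CommutativeRing 0ℓ 0ℓ

  open CommutativeRing commutativeRing public

  infix 4 _<_ _≤_

  field
    _<_                : Rel Carrier 0ℓ
    isStrictTotalOrder : IsStrictTotalOrder _≈_ _<_
    0<1                : 0# < 1#
    +-monoˡ-<          : ∀ z {x y} → x < y → x + z < y + z
    *-pos              : ∀ {x y} → 0# < x → 0# < y → 0# < x * y
    inverse            : ∀ x → ¬ x ≈ 0# → ∃[ y ] x * y ≈ 1#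

  open IsStrictTotalOrder isStrictTotalOrder public
    using (compare; _<?_)

  _≤_ : Rel Carrier 0ℓ
  x ≤ y = ¬ y < x

  IsUpperBound : Pred Carrier 0ℓ → Carrier → Set
  IsUpperBound P b = ∀ p → P p → p ≤ b

  IsSupremum : Pred Carrier 0ℓ → Carrier → Set
  IsSupremum P s = IsUpperBound P s × (∀ x → x < s → ∃[ p ] P p × x < p)

  field
    complete : (P : Pred Carrier 0ℓ) → ∃ P → ∃ (IsUpperBound P) → ∃ (IsSupremum P)

------------------------------------------------------------------------
-- Words and substitutions over {A, B, C}

Letter : Set
Letter = Fin 3

pattern A = zero
pattern B = suc zero
pattern C = suc (suc zero)

InfiniteWord : Set
InfiniteWord = ℕ → Letter

record Substitution : Set where
  open MonoidMorphisms (++-[]-rawMonoid Letter) (++-[]-rawMonoid Letter)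
  field
    ⟦_⟧                  : List Letter → List Letter
    isMonoidHomomorphism : IsMonoidHomomorphism ⟦_⟧
    nonErasing           : ∀ x → ⟦ [ x ] ⟧ ≢ []

toList⁺ : (w : List Letter) → w ≢ [] → List⁺ Letter
toList⁺ []      w≢[] = ⊥-elim (w≢[] refl)
toList⁺ (x ∷ w) _    = x ∷ w

-- x w (W 0) (W 1) …
prepend : Letter → List Letter → (ℕ → List⁺ Letter) → InfiniteWord
prepend x w       W zero    = x
prepend x (y ∷ w) W (suc n) = prepend y w W n
prepend x []      W (suc n) = prepend (head (W 0)) (tail (W 0)) (W ∘ suc) n

-- (W 0) (W 1) (W 2) …
concat∞ : (ℕ → List⁺ Letter) → InfiniteWord
concat∞ W = prepend (head (W 0)) (tail (W 0)) (W ∘ suc)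

infixr 5 _$∞_

_$∞_ : Substitution → InfiniteWord → InfiniteWord
φ $∞ u = concat∞ λ n → toList⁺ ⟦ [ u n ] ⟧ (nonErasing (u n))
  where open Substitution φ

Matrix : Set
Matrix = Letter → Letter → ℕ

identity : Matrix
identity i j = if does (i ≟ j) then 1 else 0

_⊗_ : Matrix → Matrix → Matrix
(M ⊗ N) i j = sum (tabulate λ k → M i k ℕ.* N k j)

power : Matrix → ℕ → Matrix
power M = fold identity (M ⊗_)

∣_∣[_] : List Letter → Letter → ℕ
∣ w ∣[ a ] = length (filter (_≟ a) w)

incidence : Substitution → Matrix
incidence φ i j = ∣ ⟦ [ i ] ⟧ ∣[ j ]
  where open Substitution φ

Primitive : Substitution → Set
Primitive φ = ∃[ k ] ∀ i j → 0 ℕ.< power (incidence φ) k i j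

------------------------------------------------------------------------
-- Integer polynomials of degree exactly two

record Quadratic : Set where
  field
    a b c : ℤ
    a≢0   : a ≢ + 0

------------------------------------------------------------------------
-- Notions over the real numbers

module Reals (ℝ : CompleteOrderedField) where
  open CompleteOrderedField ℝ public
  open RawMonoidDefinitions +-rawMonoid using () renaming (_×_ to _·_)

  infix 4 _∈[_,_⟩ _∈⟨0,1⟩ _∈ℤ+ℤ_

  _∈[_,_⟩ : Carrier → Carrier → Carrier → Set
  x ∈[ a , b ⟩ = a ≤ x × x < b

  _∈⟨0,1⟩ : Carrier → Set
  x ∈⟨0,1⟩ = 0# < x × x < 1#

  max : Carrier → Carrier → Carrier
  max x y = if does (x <? y) then y else x

  fromℤ : ℤ → Carrier
  fromℤ (+ n)    = n · 1#
  fromℤ -[1+ n ] = - (suc n · 1#)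

  Irrational : Carrier → Set
  Irrational x = ¬ (∃[ p ] ∃[ q ] q ≢ + 0 × fromℤ q * x ≈ fromℤ p)

  _∈ℤ+ℤ_ : Carrier → Carrier → Set
  y ∈ℤ+ℤ x = ∃[ m ] ∃[ n ] y ≈ fromℤ m + fromℤ n * x

  IsRoot : Quadratic → Carrier → Set
  IsRoot p x = fromℤ a * (x * x) + fromℤ b * x + fromℤ c ≈ 0#
    where open Quadratic p

  QuadraticIrrational : Carrier → Set
  QuadraticIrrational x = Irrational x × ∃[ p ] IsRoot p x

  -- For a quadratic irrational x every p : Quadratic with root x is a
  -- rational multiple of the minimal polynomial of x.
  Conjugate : Carrier → Carrier → Set
  Conjugate x x′ = ¬ x′ ≈ x × ∃[ p ] IsRoot p x × IsRoot p x′

  SturmNumber : Carrier → Set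
  SturmNumber x =
    QuadraticIrrational x × x ∈⟨0,1⟩ × ∃[ x′ ] Conjugate x x′ × ¬ x′ ∈⟨0,1⟩

  module IntervalExchange (ε l c : Carrier) where

    I : Letter → Pred Carrier 0ℓ
    I A x = x ∈[ c              , c + ε + l - 1# ⟩
    I B x = x ∈[ c + ε + l - 1# , c + ε          ⟩
    I C x = x ∈[ c + ε          , c + l          ⟩

    shift : Letter → Carrier
    shift A = 1# - ε
    shift B = 1# - (ε + ε)
    shift C = - ε

    -- For x in [c, c + l) this is the unique X with I X x; the values
    -- outside that interval are immaterial, as T maps it to itself for admissible ε, l, c.
    piece : Carrier → Letter
    piece x =
      if does (x <? c + ε + l - 1#) then A else
      if does (x <? c + ε)          then B else C

    T : Carrier → Carrier
    T x = x + shift (piece x)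

    Is3iet : InfiniteWord → Set
    Is3iet u = ∀ n X → u n ≡ X ⇔ I X (fold 0# T n)

{-# OPTIONS --safe #-}

-- The points xₙ = Tⁿ(0) are the partial sums of the displacements of the letters of u.
-- As φ(u) = u, the partial sums over u of the displacements s of the words φ(A), φ(B),
-- φ(C) form a subsequence of (xₙ), and so are bounded.
--
-- First, s(B) = s(A) + s(C).  Indeed, T is the first return map of the rotation by - ε of
-- the circle [c, c + 1⟩, on which B takes two steps and A and C take one.  If
-- s(B) ≠ s(A) + s(C), the visits of the rotation to the interval I_B would have bounded
-- discrepancy.  By the argument of Gottschalk and Hedlund the partial sums would be
-- right-continuous along the orbit of 0.  But they jump at the left end p of I_B, hence
-- along the entire two-sided dense orbit of p, on one side of p, as the right end of I_B
-- is not in this orbit (l ∉ ℤ + ℤε).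
--
-- Thus s = λ t + κ (1, 2, 1) where t is the vector of displacements of the letters, and
-- boundedness forces κ = 0.  With s(X) = P_X - Q_X ε this is the equation
--   (Q_A - Q_C) ε² + (Q_C + P_C - P_A) ε - P_C = 0.
-- The polynomial is ≤ 0 at 0 and, as P_A ≤ Q_A, ≥ 0 at 1, so its two roots are not both in
-- ⟨0,1⟩.  It has degree two, since otherwise P_C = 0, that is, φ(C) is a power of C.

module Submission where

open import Defs
open import Relation.Nullary.Negation.Core using (¬_)
open import Relation.Binary.PropositionalEquality using (_≗_)
open import Algebra.Bundles using (RawRing; CommutativeRing)
import Algebra.Definitions.RawMonoid as RawMonoidDefinitions
import Algebra.Properties.Ring as RingProperties
import Algebra.Properties.Semiring.Mult as SemiringMult
import Algebra.Properties.Semiring.Mult.TCOptimised as SemiringMult′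
import Algebra.Solver.Ring as RingSolver
open import Algebra.Solver.Ring.AlmostCommutativeRing
  using (fromCommutativeRing; _-Raw-AlmostCommutative⟶_)
open import Data.Empty using (⊥; ⊥-elim)
open import Data.Integer.Base as ℤ using (ℤ; +_; -[1+_])
import Data.Integer.Properties as ℤ
open import Data.List.Base using (List; []; _∷_; [_]; length)
open import Data.List.NonEmpty.Base using (List⁺; head; tail; toList)
open import Data.Maybe.Base using (Maybe; just; nothing)
open import Data.Nat.Base as ℕ using (ℕ; zero; suc)
open import Data.Nat.GeneralisedArithmetic using (fold; fold-+)
import Data.Nat.Properties as ℕ
open import Data.Product.Base using (∃-syntax; _×_; _,_; proj₁; proj₂)
open import Data.Sum.Base using (_⊎_; inj₁; inj₂)
open import Data.Unit.Base using (⊤)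
open import Function.Base using (_∘_; case_of_)
open import Function.Bundles using (Equivalence)
open import Relation.Binary.Definitions using (tri<; tri≈; tri>)
open import Relation.Binary.PropositionalEquality.Core as ≡ using (_≡_; _≢_)
open import Relation.Binary.Structures using (IsStrictTotalOrder)
open import Relation.Nullary.Decidable using (yes; no; dec-true; dec-false)

module _ (ℝ : CompleteOrderedField) where
  open Reals ℝ
  open RawMonoidDefinitions +-rawMonoid using () renaming (_×_ to _·_; _×′_ to _·′_)
  open SemiringMult semiring
    using (×-homo-+; ×1-homo-*; ×-congʳ; ×-assocˡ; ×-assoc-*)
  open SemiringMult′ semiring using () renaming (×ᵤ≈× to ·≈·′)
  open RingProperties ring
    using (-‿distribˡ-*; -‿distribʳ-*; -‿+-comm; -‿involutive; -0#≈0#)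
  open import Relation.Binary.Reasoning.Setoid setoid

  -- The homomorphism from the integers into the field, and a ring solver over it.

  opaque
    fromℤ-⊖ : ∀ m n → fromℤ (m ℤ.⊖ n) ≈ m · 1# - n · 1#
    fromℤ-⊖ zero    zero    = sym (-‿inverseʳ 0#)
    fromℤ-⊖ zero    (suc n) = sym (+-identityˡ _)
    fromℤ-⊖ (suc m) zero    = sym (trans (+-congˡ -0#≈0#) (+-identityʳ _))
    fromℤ-⊖ (suc m) (suc n) = begin
      fromℤ (suc m ℤ.⊖ suc n)                ≡⟨ ≡.cong fromℤ (ℤ.[1+m]⊖[1+n]≡m⊖n m n) ⟩
      fromℤ (m ℤ.⊖ n)                        ≈⟨ fromℤ-⊖ m n ⟩
      m · 1# - n · 1#                        ≈⟨ +-congʳ (+-identityˡ _) ⟨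
      (0# + m · 1#) - n · 1#                 ≈⟨ +-congʳ (+-congʳ (-‿inverseˡ 1#)) ⟨
      ((- 1# + 1#) + m · 1#) - n · 1#        ≈⟨ +-congʳ (+-assoc _ _ _) ⟩
      (- 1# + suc m · 1#) - n · 1#           ≈⟨ +-congʳ (+-comm _ _) ⟩
      (suc m · 1# - 1#) - n · 1#             ≈⟨ +-assoc _ _ _ ⟩
      suc m · 1# + (- 1# - n · 1#)           ≈⟨ +-congˡ (-‿+-comm _ _) ⟩
      suc m · 1# - suc n · 1#                ∎

    fromℤ-neg : ∀ i → fromℤ (ℤ.- i) ≈ - fromℤ i
    fromℤ-neg (+ zero)  = sym -0#≈0#
    fromℤ-neg (+ suc n) = refl
    fromℤ-neg -[1+ n ]  = sym (-‿involutive _)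

    fromℤ-+ : ∀ i j → fromℤ (i ℤ.+ j) ≈ fromℤ i + fromℤ j
    fromℤ-+ (+ m)    (+ n)    = ×-homo-+ 1# m n
    fromℤ-+ (+ m)    -[1+ n ] = fromℤ-⊖ m (suc n)
    fromℤ-+ -[1+ m ] (+ n)    = trans (fromℤ-⊖ n (suc m)) (+-comm _ _)
    fromℤ-+ -[1+ m ] -[1+ n ] = begin
      - (suc (suc (m ℕ.+ n)) · 1#)     ≡⟨ ≡.cong (λ k → - (suc k · 1#)) (≡.sym (ℕ.+-suc m n)) ⟩
      - ((suc m ℕ.+ suc n) · 1#)       ≈⟨ -‿cong (×-homo-+ 1# (suc m) (suc n)) ⟩
      - (suc m · 1# + suc n · 1#)      ≈⟨ -‿+-comm _ _ ⟨
      - (suc m · 1#) - suc n · 1#      ∎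

    fromℤ-* : ∀ i j → fromℤ (i ℤ.* j) ≈ fromℤ i * fromℤ j
    fromℤ-* (+ m)    j = pos m j
      where
      pos : ∀ m j → fromℤ (+ m ℤ.* j) ≈ fromℤ (+ m) * fromℤ j
      pos m (+ n) = begin
        fromℤ (+ m ℤ.* + n)              ≡⟨ ≡.cong fromℤ (≡.sym (ℤ.pos-* m n)) ⟩
        (m ℕ.* n) · 1#                   ≈⟨ ×1-homo-* m n ⟩
        (m · 1#) * (n · 1#)              ∎
      pos m -[1+ n ] = begin
        fromℤ (+ m ℤ.* -[1+ n ])         ≡⟨ ≡.cong fromℤ (≡.sym (ℤ.neg-distribʳ-* (+ m) (+ suc n))) ⟩
        fromℤ (ℤ.- (+ m ℤ.* + suc n))    ≈⟨ fromℤ-neg (+ m ℤ.* + suc n) ⟩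
        - fromℤ (+ m ℤ.* + suc n)        ≈⟨ -‿cong (pos m (+ suc n)) ⟩
        - (m · 1# * suc n · 1#)          ≈⟨ -‿distribʳ-* _ _ ⟩
        m · 1# * - (suc n · 1#)          ∎
    fromℤ-* -[1+ m ] j = begin
      fromℤ (-[1+ m ] ℤ.* j)             ≡⟨ ≡.cong fromℤ (≡.sym (ℤ.neg-distribˡ-* (+ suc m) j)) ⟩
      fromℤ (ℤ.- (+ suc m ℤ.* j))        ≈⟨ fromℤ-neg (+ suc m ℤ.* j) ⟩
      - fromℤ (+ suc m ℤ.* j)            ≈⟨ -‿cong (fromℤ-* (+ suc m) j) ⟩
      - (suc m · 1# * fromℤ j)           ≈⟨ -‿distribˡ-* _ _ ⟩
      - (suc m · 1#) * fromℤ j           ∎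

  -- Unlike fromℤ, this interprets the literals 0 and 1 as 0# and 1# definitionally.
  ⟦_⟧ℤ : ℤ → Carrier
  ⟦ + n ⟧ℤ      = n ·′ 1#
  ⟦ -[1+ n ] ⟧ℤ = - (suc n ·′ 1#)

  ⟦⟧ℤ≈fromℤ : ∀ i → ⟦ i ⟧ℤ ≈ fromℤ i
  ⟦⟧ℤ≈fromℤ (+ n)    = sym (·≈·′ n 1#)
  ⟦⟧ℤ≈fromℤ -[1+ n ] = -‿cong (sym (·≈·′ (suc n) 1#))

  ℤ-rawRing : RawRing _ _
  ℤ-rawRing = CommutativeRing.rawRing ℤ.+-*-commutativeRing

  ℤ⟶ℝ : ℤ-rawRing -Raw-AlmostCommutative⟶ fromCommutativeRing commutativeRing
  ℤ⟶ℝ = record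
    { ⟦_⟧    = ⟦_⟧ℤ
    ; +-homo = λ i j → trans (⟦⟧ℤ≈fromℤ (i ℤ.+ j)) (trans (fromℤ-+ i j)
                         (sym (+-cong (⟦⟧ℤ≈fromℤ i) (⟦⟧ℤ≈fromℤ j))))
    ; *-homo = λ i j → trans (⟦⟧ℤ≈fromℤ (i ℤ.* j)) (trans (fromℤ-* i j)
                         (sym (*-cong (⟦⟧ℤ≈fromℤ i) (⟦⟧ℤ≈fromℤ j))))
    ; -‿homo = λ i → trans (⟦⟧ℤ≈fromℤ (ℤ.- i)) (trans (fromℤ-neg i)
                       (sym (-‿cong (⟦⟧ℤ≈fromℤ i))))
    ; 0-homo = refl
    ; 1-homo = refl
    }

  coefficients≟ : ∀ i j → Maybe (⟦ i ⟧ℤ ≈ ⟦ j ⟧ℤ)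
  coefficients≟ i j with i ℤ.≟ j
  ... | yes i≡j = just (reflexive (≡.cong ⟦_⟧ℤ i≡j))
  ... | no _    = nothing

  module Solver = RingSolver ℤ-rawRing (fromCommutativeRing commutativeRing) ℤ⟶ℝ coefficients≟
  open Solver using (solve; _:=_; _:+_; _:*_; _:-_; :-_; con)

  -- Inequalities in an ordered field.

  open IsStrictTotalOrder isStrictTotalOrder
    using (irrefl; asym; <-resp-≈) renaming (trans to <-trans)

  opaque
    <-respʳ : ∀ {x y z} → y ≈ z → x < y → x < z
    <-respʳ = proj₁ <-resp-≈

    <-respˡ : ∀ {x y z} → y ≈ z → y < x → z < x
    <-respˡ = proj₂ <-resp-≈

    <⇒≤ : ∀ {x y} → x < y → x ≤ y
    <⇒≤ = asym

    ≈⇒≤ : ∀ {x y} → x ≈ y → x ≤ y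
    ≈⇒≤ x≈y y<x = irrefl (sym x≈y) y<x

    ≤⇒<⊎≈ : ∀ {x y} → x ≤ y → x < y ⊎ x ≈ y
    ≤⇒<⊎≈ {x} {y} x≤y with compare x y
    ... | tri< x<y _ _ = inj₁ x<y
    ... | tri≈ _ x≈y _ = inj₂ x≈y
    ... | tri> _ _ y<x = ⊥-elim (x≤y y<x)

    <⊎≥ : ∀ x y → x < y ⊎ y ≤ x
    <⊎≥ x y with compare x y
    ... | tri< x<y _ _  = inj₁ x<y
    ... | tri≈ x≮y _ _  = inj₂ x≮y
    ... | tri> x≮y _ _  = inj₂ x≮y

    <-≤-trans : ∀ {x y z} → x < y → y ≤ z → x < z
    <-≤-trans x<y y≤z with ≤⇒<⊎≈ y≤z
    ... | inj₁ y<z = <-trans x<y y<z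
    ... | inj₂ y≈z = <-respʳ y≈z x<y

    ≤-<-trans : ∀ {x y z} → x ≤ y → y < z → x < z
    ≤-<-trans x≤y y<z with ≤⇒<⊎≈ x≤y
    ... | inj₁ x<y = <-trans x<y y<z
    ... | inj₂ x≈y = <-respˡ (sym x≈y) y<z

    ≤-trans : ∀ {x y z} → x ≤ y → y ≤ z → x ≤ z
    ≤-trans x≤y y≤z z<x = x≤y (≤-<-trans y≤z z<x)

  infixl 6 _⟨<+<⟩_ _⟨≤+<⟩_ _⟨<+≤⟩_ _⟨≤+≤⟩_

  opaque
    _⟨<+<⟩_ : ∀ {x y z w} → x < y → z < w → x + z < y + w
    x<y ⟨<+<⟩ z<w = <-trans (+-monoˡ-< _ x<y)
      (<-respˡ (+-comm _ _) (<-respʳ (+-comm _ _) (+-monoˡ-< _ z<w)))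

    _⟨≤+<⟩_ : ∀ {x y z w} → x ≤ y → z < w → x + z < y + w
    x≤y ⟨≤+<⟩ z<w with ≤⇒<⊎≈ x≤y
    ... | inj₁ x<y = x<y ⟨<+<⟩ z<w
    ... | inj₂ x≈y = <-respˡ (+-comm _ _) (<-respʳ (trans (+-comm _ _) (+-congʳ x≈y)) (+-monoˡ-< _ z<w))

    _⟨<+≤⟩_ : ∀ {x y z w} → x < y → z ≤ w → x + z < y + w
    x<y ⟨<+≤⟩ z≤w = <-respˡ (+-comm _ _) (<-respʳ (+-comm _ _) (z≤w ⟨≤+<⟩ x<y))

    _⟨≤+≤⟩_ : ∀ {x y z w} → x ≤ y → z ≤ w → x + z ≤ y + w
    (x≤y ⟨≤+≤⟩ z≤w) y+w<x+z = irrefl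
      (solve 4 (λ x y z w → y :+ w :+ x :+ z := x :+ z :+ y :+ w) refl _ _ _ _)
      (y+w<x+z ⟨<+≤⟩ x≤y ⟨<+≤⟩ z≤w)

    -- This is the device for linear arithmetic: hypotheses are added up with `_⟨<+<⟩_` and its
    -- variants, and the solver checks that the gap so obtained equals the gap in the goal. Most
    -- inequalities below are derived in this way.
    <-by : ∀ {x y z w} → x < y → y - x ≈ w - z → z < w
    <-by {x} {y} {z} {w} x<y y-x≈w-z = <-respˡ
      (solve 2 (λ x z → x :+ (z :- x) := z) refl x z)
      (<-respʳ (begin
        y + (z - x)  ≈⟨ solve 3 (λ x y z → y :+ (z :- x) := (y :- x) :+ z) refl x y z ⟩
        (y - x) + z  ≈⟨ +-congʳ y-x≈w-z ⟩
        (w - z) + z  ≈⟨ solve 2 (λ z w → (w :- z) :+ z := w) refl z w ⟩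
        w            ∎) (+-monoˡ-< (z - x) x<y))

    ≤-by : ∀ {x y z w} → x ≤ y → y - x ≈ w - z → z ≤ w
    ≤-by {x} {y} {z} {w} x≤y y-x≈w-z w<z = x≤y (<-by w<z (begin
      z - w      ≈⟨ solve 2 (λ z w → z :- w := :- (w :- z)) refl z w ⟩
      - (w - z)  ≈⟨ -‿cong y-x≈w-z ⟨
      - (y - x)  ≈⟨ solve 2 (λ x y → :- (y :- x) := x :- y) refl x y ⟩
      x - y      ∎))

  opaque
    x-y<x : ∀ {x y} → 0# < y → x - y < x
    x-y<x 0<y = <-by 0<y (solve 2 (λ x y → y :- con (+ 0) := x :- (x :- y)) refl _ _)

    x<0⇒0<-x : ∀ {x} → x < 0# → 0# < - x
    x<0⇒0<-x x<0 = <-by x<0 (solve 1 (λ x → con (+ 0) :- x := :- x :- con (+ 0)) refl _)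

    0<x⇒-x<0 : ∀ {x} → 0# < x → - x < 0#
    0<x⇒-x<0 0<x = <-by 0<x (solve 1 (λ x → x :- con (+ 0) := con (+ 0) :- :- x) refl _)

    x<0⇒x+x<x : ∀ {x} → x < 0# → x + x < x
    x<0⇒x+x<x x<0 = <-by x<0 (solve 1 (λ x → con (+ 0) :- x := x :- (x :+ x)) refl _)

    x<y⇒0<y-x : ∀ {x y} → x < y → 0# < y - x
    x<y⇒0<y-x x<y = <-by x<y (solve 2 (λ x y → y :- x := y :- x :- con (+ 0)) refl _ _)

    x+[y-x]≈y : ∀ x y → x + (y - x) ≈ y
    x+[y-x]≈y = solve 2 (λ x y → x :+ (y :- x) := y) refl

    0≤n·1 : ∀ n → 0# ≤ n · 1#
    0≤n·1 zero    = ≈⇒≤ refl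
    0≤n·1 (suc n) = ≤-by (<⇒≤ 0<1 ⟨≤+≤⟩ 0≤n·1 n)
      (solve 1 (λ x → (con (+ 1) :+ x) :- (con (+ 0) :+ con (+ 0)) := (con (+ 1) :+ x) :- con (+ 0)) refl (n · 1#))

  -- The Archimedean property and its consequences.

  opaque
    -- Completeness is applied to the multiples of `g` that are at most `x`.
    floor : ∀ {x g} → 0# ≤ x → 0# < g → ∃[ n ] n · g ≤ x × x < suc n · g
    floor {x} {g} 0≤x 0<g with complete Multiple (0# , 0 , refl , 0≤x) (x , λ _ → proj₂ ∘ proj₂)
      where
      Multiple : Carrier → Set
      Multiple y = ∃[ n ] y ≈ n · g × y ≤ x
    ... | s , isUpper , isLeast
      -- A multiple of `g` beyond `s - g` is the last one: the next exceeds the supremum `s`, hence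
      -- is not at most `x`.
      with isLeast (s - g) (x-y<x 0<g)
    ... | y , (n , y≈ng , y≤x) , s-g<y with <⊎≥ x (suc n · g)
    ... | inj₁ x<[1+n]g = n , ≤-trans (≈⇒≤ (sym y≈ng)) y≤x , x<[1+n]g
    ... | inj₂ [1+n]g≤x = ⊥-elim (isUpper (suc n · g) (suc n , refl , [1+n]g≤x)
      (<-by s-g<y (begin
        y - (s - g)      ≈⟨ +-congʳ y≈ng ⟩
        n · g - (s - g)  ≈⟨ solve 3 (λ y s g → y :- (s :- g) := (g :+ y) :- s) refl (n · g) s g ⟩
        suc n · g - s    ∎)))

  opaque
    positive-inverse : ∀ {x} → 0# < x → ∃[ y ] 0# < y × x * y ≈ 1#
    positive-inverse {x} 0<x with inverse x (λ x≈0 → irrefl (sym x≈0) 0<x)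
    ... | y , xy≈1 with compare 0# y
    ... | tri< 0<y _ _ = y , 0<y , xy≈1
    ... | tri≈ _ 0≈y _ = ⊥-elim (irrefl (begin
      0#      ≈⟨ zeroʳ x ⟨
      x * 0#  ≈⟨ *-congˡ 0≈y ⟩
      x * y   ≈⟨ xy≈1 ⟩
      1#      ∎) 0<1)
    ... | tri> _ _ y<0 = ⊥-elim (irrefl {0#} refl (<-by (0<1 ⟨<+<⟩ *-pos 0<x
      (x<0⇒0<-x y<0)) (begin
      1# + x * - y - (0# + 0#)
        ≈⟨ solve 2 (λ x y → con (+ 1) :+ x :* :- y :- (con (+ 0) :+ con (+ 0)) := con (+ 1) :- x :* y) refl x y ⟩
      1# - x * y  ≈⟨ +-congˡ (-‿cong xy≈1) ⟩
      1# - 1#     ≈⟨ solve 0 (con (+ 1) :- con (+ 1) := con (+ 0) :- con (+ 0)) refl ⟩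
      0# - 0#     ∎)))

  opaque
    lowerBound : ∀ {a b} → 0# < a → 0# < b → ∃[ h ] 0# < h × h ≤ a × h ≤ b
    lowerBound {a} {b} 0<a 0<b with <⊎≥ a b
    ... | inj₁ a<b = a , 0<a , ≈⇒≤ refl , <⇒≤ a<b
    ... | inj₂ b≤a = b , 0<b , b≤a , ≈⇒≤ refl

  opaque
    above : ∀ x → ∃[ m ] 0# ≤ x + fromℤ m
    above x with <⊎≥ x 0#
    ... | inj₂ 0≤x = + 0 , ≤-by 0≤x (solve 1 (λ x → x :- con (+ 0) := x :+ con (+ 0) :- con (+ 0)) refl x)
    ... | inj₁ x<0 with floor {x = - x} (<⇒≤ (x<0⇒0<-x x<0)) 0<1
    ... | n , _ , -x<1+n = + suc n , <⇒≤ (<-by -x<1+n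
      (solve 2 (λ x n → n :- :- x := x :+ n :- con (+ 0)) refl x (suc n · 1#)))

  opaque
    ·-neg : ∀ n x → n · (- x) ≈ - (n · x)
    ·-neg zero    x = sym -0#≈0#
    ·-neg (suc n) x = trans (+-congˡ (·-neg n x)) (-‿+-comm x (n · x))

    fromℤ-·1 : ∀ n x → fromℤ (+ n) * x ≈ n · x
    fromℤ-·1 n x = trans (×-assoc-* n 1# x) (×-congʳ n (*-identityˡ x))

  -- Density of ℤ + ℤε

  module _ {ε : Carrier} where

    opaque
      ∈ℤ+ℤ-resp : ∀ {x y} → x ≈ y → x ∈ℤ+ℤ ε → y ∈ℤ+ℤ ε
      ∈ℤ+ℤ-resp x≈y (m , n , eq) = m , n , trans (sym x≈y) eq

      ∈ℤ+ℤ-+ : ∀ {x y} → x ∈ℤ+ℤ ε → y ∈ℤ+ℤ ε → (x + y) ∈ℤ+ℤ ε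
      ∈ℤ+ℤ-+ {x} {y} (m , n , eq) (m′ , n′ , eq′) = m ℤ.+ m′ , n ℤ.+ n′ , (begin
        x + y                                                  ≈⟨ +-cong eq eq′ ⟩
        (fromℤ m + fromℤ n * ε) + (fromℤ m′ + fromℤ n′ * ε)    ≈⟨ solve 5 (λ m n m′ n′ e →
          (m :+ n :* e) :+ (m′ :+ n′ :* e) := (m :+ m′) :+ (n :+ n′) :* e) refl _ _ _ _ _ ⟩
        (fromℤ m + fromℤ m′) + (fromℤ n + fromℤ n′) * ε        ≈⟨ +-cong (fromℤ-+ m m′) (*-congʳ (fromℤ-+ n n′)) ⟨
        fromℤ (m ℤ.+ m′) + fromℤ (n ℤ.+ n′) * ε                ∎)

      ∈ℤ+ℤ-neg : ∀ {x} → x ∈ℤ+ℤ ε → (- x) ∈ℤ+ℤ ε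
      ∈ℤ+ℤ-neg {x} (m , n , eq) = ℤ.- m , ℤ.- n , (begin
        - x                                    ≈⟨ -‿cong eq ⟩
        - (fromℤ m + fromℤ n * ε)              ≈⟨ solve 3 (λ m n e → :- (m :+ n :* e) := :- m :+ :- n :* e) refl _ _ _ ⟩
        - fromℤ m + - fromℤ n * ε              ≈⟨ +-cong (fromℤ-neg m) (*-congʳ (fromℤ-neg n)) ⟨
        fromℤ (ℤ.- m) + fromℤ (ℤ.- n) * ε      ∎)

      fromℤ∈ℤ+ℤ : ∀ m → fromℤ m ∈ℤ+ℤ ε
      fromℤ∈ℤ+ℤ m = m , + 0 , solve 2 (λ m e → m := m :+ con (+ 0) :* e) refl (fromℤ m) ε

      1∈ℤ+ℤ : 1# ∈ℤ+ℤ ε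
      1∈ℤ+ℤ = ∈ℤ+ℤ-resp (+-identityʳ 1#) (fromℤ∈ℤ+ℤ (+ 1))

      ε∈ℤ+ℤ : ε ∈ℤ+ℤ ε
      ε∈ℤ+ℤ = + 0 , + 1 , solve 1 (λ e → e := con (+ 0) :+ (con (+ 1) :+ con (+ 0)) :* e) refl ε

      ·∈ℤ+ℤ : ∀ n {x} → x ∈ℤ+ℤ ε → (n · x) ∈ℤ+ℤ ε
      ·∈ℤ+ℤ zero    x∈ = fromℤ∈ℤ+ℤ (+ 0)
      ·∈ℤ+ℤ (suc n) x∈ = ∈ℤ+ℤ-+ x∈ (·∈ℤ+ℤ n x∈)

    -- The displacements of points under the iterates of the rotation by - ε.
    Displacement : Carrier → Set
    Displacement d = ∃[ m ] ∃[ n ] d ≈ fromℤ m - n · ε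

    opaque
      Displacement-+ : ∀ {x y} → Displacement x → Displacement y → Displacement (x + y)
      Displacement-+ {x} {y} (m , n , eq) (m′ , n′ , eq′) = m ℤ.+ m′ , n ℕ.+ n′ , (begin
        x + y                                         ≈⟨ +-cong eq eq′ ⟩
        (fromℤ m - n · ε) + (fromℤ m′ - n′ · ε)       ≈⟨ solve 4 (λ m n m′ n′ →
          (m :- n) :+ (m′ :- n′) := (m :+ m′) :- (n :+ n′)) refl _ _ _ _ ⟩
        (fromℤ m + fromℤ m′) - (n · ε + n′ · ε)       ≈⟨ +-cong (fromℤ-+ m m′) (-‿cong (×-homo-+ ε n n′)) ⟨
        fromℤ (m ℤ.+ m′) - (n ℕ.+ n′) · ε             ∎)

      fromℤ-Displacement : ∀ m → Displacement (fromℤ m)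
      fromℤ-Displacement m = m , 0 , solve 1 (λ m → m := m :- con (+ 0)) refl (fromℤ m)

      ·-Displacement : ∀ n {x} → Displacement x → Displacement (n · x)
      ·-Displacement zero    x∈ = fromℤ-Displacement (+ 0)
      ·-Displacement (suc n) x∈ = Displacement-+ x∈ (·-Displacement n x∈)

      Displacement⇒∈ℤ+ℤ : ∀ {x} → Displacement x → x ∈ℤ+ℤ ε
      Displacement⇒∈ℤ+ℤ (m , n , eq) =
        ∈ℤ+ℤ-resp (sym eq) (∈ℤ+ℤ-+ (fromℤ∈ℤ+ℤ m) (∈ℤ+ℤ-neg (·∈ℤ+ℤ n ε∈ℤ+ℤ)))

      -- The rotation is only iterated forwards, so a displacement subtracts a nonnegative multiple
      -- of ε. The sign of the coefficient of ε decides between `x` and `- x`.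
      displacement-sign : ∀ {x} → x ∈ℤ+ℤ ε → Displacement x ⊎ Displacement (- x)
      displacement-sign {x} (m , + n , eq) = inj₂ (ℤ.- m , n , (begin
        - x                              ≈⟨ -‿cong eq ⟩
        - (fromℤ m + fromℤ (+ n) * ε)    ≈⟨ -‿+-comm _ _ ⟨
        - fromℤ m - fromℤ (+ n) * ε      ≈⟨ +-cong (sym (fromℤ-neg m)) (-‿cong (fromℤ-·1 n ε)) ⟩
        fromℤ (ℤ.- m) - n · ε            ∎))
      displacement-sign {x} (m , -[1+ n ] , eq) = inj₁ (m , suc n , (begin
        x                                    ≈⟨ eq ⟩
        fromℤ m + - fromℤ (+ suc n) * ε      ≈⟨ +-congˡ (-‿distribˡ-* _ _) ⟨
        fromℤ m - fromℤ (+ suc n) * ε        ≈⟨ +-congˡ (-‿cong (fromℤ-·1 (suc n) ε)) ⟩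
        fromℤ m - suc n · ε                  ∎))

    module _ (0<ε : 0# < ε) (irrational : Irrational ε) where

      opaque
        -- A common generator γ would give ε = j / k, where k is nonzero because 1 is.
        not-cyclic : ∀ {γ} → ∃[ k ] 1# ≈ k · γ → ∃[ j ] ε ≈ j · γ → ⊥
        not-cyclic {γ} (k , 1≈kγ) (j , ε≈jγ) = irrational (+ j , + k , k≢0 , (begin
          fromℤ (+ k) * ε    ≈⟨ fromℤ-·1 k ε ⟩
          k · ε              ≈⟨ ×-congʳ k ε≈jγ ⟩
          k · (j · γ)        ≈⟨ ×-assocˡ γ k j ⟩
          (k ℕ.* j) · γ      ≡⟨ ≡.cong (_· γ) (ℕ.*-comm k j) ⟩
          (j ℕ.* k) · γ      ≈⟨ ×-assocˡ γ j k ⟨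
          j · (k · γ)        ≈⟨ ×-congʳ j 1≈kγ ⟨
          j · 1#             ∎))
          where
          k≢0 : + k ≢ + 0
          k≢0 ≡.refl = irrefl (sym 1≈kγ) 0<1

      opaque
        -- If the supremum of the negative elements of ℤ + ℤε were negative, it would
        -- be attained and ℤ + ℤε would be cyclic.
        small-positive : ∀ {η} → 0# < η → ∃[ g ] 0# < g × g < η × g ∈ℤ+ℤ ε
        small-positive {η} 0<η
          with complete (λ x → x < 0# × x ∈ℤ+ℤ ε)
                 (- 1# , 0<x⇒-x<0 0<1 , ∈ℤ+ℤ-neg 1∈ℤ+ℤ)
                 (0# , λ _ → <⇒≤ ∘ proj₁)
        ... | s , isUpper , isLeast with <⊎≥ s 0#
        ... | inj₂ 0≤s = let
            g , (g<0 , g∈) , -η<g = isLeast (- η) (<-by (0≤s ⟨≤+<⟩ 0<η)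
              (solve 2 (λ s η → (s :+ η) :- (con (+ 0) :+ con (+ 0)) := s :- :- η) refl s η))
          in - g , x<0⇒0<-x g<0
                 , <-by -η<g (solve 2 (λ g η → g :- :- η := η :- :- g) refl g η)
                 , ∈ℤ+ℤ-neg g∈
        ... | inj₁ s<0 with isLeast (s + s) (x<0⇒x+x<x s<0)
        ... | g , (g<0 , g∈) , 2s<g = ⊥-elim (not-cyclic (multiple (<⇒≤ 0<1) 1∈ℤ+ℤ) (multiple (<⇒≤ 0<ε) ε∈ℤ+ℤ))
          where
          -- If g < s, there is an element g′ with g < g′ ≤ s, and 2s < g then puts the negative
          -- element g - g′ above the supremum.
          s≤g : s ≤ g
          s≤g g<s with isLeast g g<s
          ... | g′ , (g′<0 , g′∈) , g<g′ = isUpper (g - g′)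
            ( <-by g<g′ (solve 2 (λ g g′ → g′ :- g := con (+ 0) :- (g :- g′)) refl g g′)
            , ∈ℤ+ℤ-+ g∈ (∈ℤ+ℤ-neg g′∈))
            (<-by (isUpper g′ (g′<0 , g′∈) ⟨≤+<⟩ 2s<g)
              (solve 3 (λ s g g′ → (s :+ g) :- (g′ :+ (s :+ s)) := (g :- g′) :- s) refl s g g′))

          -- Division with remainder by `- g`: a nonzero remainder, negated, would be an element
          -- strictly between `s` and 0.
          multiple : ∀ {x} → 0# ≤ x → x ∈ℤ+ℤ ε → ∃[ n ] x ≈ n · (- g)
          multiple {x} 0≤x x∈ with floor 0≤x (x<0⇒0<-x g<0)
          ... | n , nγ≤x , x<[1+n]γ with ≤⇒<⊎≈ nγ≤x
          ... | inj₂ nγ≈x = n , sym nγ≈x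
          ... | inj₁ nγ<x = ⊥-elim (isUpper (n · (- g) - x)
            ( <-by nγ<x (solve 2 (λ y x → x :- y := con (+ 0) :- (y :- x)) refl (n · (- g)) x)
            , ∈ℤ+ℤ-+ (·∈ℤ+ℤ n (∈ℤ+ℤ-neg g∈)) (∈ℤ+ℤ-neg x∈))
            (<-by (s≤g ⟨≤+<⟩ x<[1+n]γ)
              (solve 4 (λ s g x y → (g :+ (:- g :+ y)) :- (s :+ x) := (y :- x) :- s) refl s g x (n · (- g)))))

      opaque
        -- Steps of length g < b - a cannot jump over the interval. If `g` is a displacement, an
        -- integer shift takes `x` to a point at most `a`, and steps of `g` lead upwards into the
        -- interval; if `- g` is one, the shift goes to a point at least `b` and the steps lead
        -- downwards.
        dense : ∀ x {a b} → a < b → ∃[ d ] Displacement d × a < x + d × x + d < b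
        dense x {a} {b} a<b with small-positive (x<y⇒0<y-x a<b)
        ... | g , 0<g , g<b-a , g∈ with displacement-sign g∈
        ... | inj₁ g-disp with above (a - x)
        ... | m , 0≤a-x+m with floor 0≤a-x+m 0<g
        ... | k , kg≤y , y<[1+k]g =
            fromℤ (ℤ.- m) + suc k · g
          , Displacement-+ (fromℤ-Displacement (ℤ.- m)) (·-Displacement (suc k) g-disp)
          , <-by y<[1+k]g (begin
              suc k · g - (a - x + fromℤ m)          ≈⟨ solve 4 (λ y a x m →
                y :- (a :- x :+ m) := x :+ (:- m :+ y) :- a) refl (suc k · g) a x (fromℤ m) ⟩
              x + (- fromℤ m + suc k · g) - a        ≈⟨ +-congʳ (+-congˡ (+-congʳ (fromℤ-neg m))) ⟨
              x + (fromℤ (ℤ.- m) + suc k · g) - a    ∎)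
          , <-by (kg≤y ⟨≤+<⟩ g<b-a) (begin
              a - x + fromℤ m + (b - a) - (k · g + g)    ≈⟨ solve 6 (λ y a x m b g →
                a :- x :+ m :+ (b :- a) :- (y :+ g) := b :- (x :+ (:- m :+ (g :+ y)))) refl (k · g) a x (fromℤ m) b g ⟩
              b - (x + (- fromℤ m + suc k · g))          ≈⟨ +-congˡ (-‿cong (+-congˡ (+-congʳ (fromℤ-neg m)))) ⟨
              b - (x + (fromℤ (ℤ.- m) + suc k · g))      ∎)
        dense x {a} {b} a<b | g , 0<g , g<b-a , g∈ | inj₂ g-disp with above (x - b)
        ... | m , 0≤x-b+m with floor 0≤x-b+m 0<g
        ... | k , kg≤y , y<[1+k]g =
            fromℤ m + suc k · (- g)
          , Displacement-+ (fromℤ-Displacement m) (·-Displacement (suc k) g-disp)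
          , <-by (kg≤y ⟨≤+<⟩ g<b-a) (begin
              x - b + fromℤ m + (b - a) - (k · g + g)    ≈⟨ solve 6 (λ y a x m b g →
                x :- b :+ m :+ (b :- a) :- (y :+ g) := x :+ (m :- (g :+ y)) :- a) refl (k · g) a x (fromℤ m) b g ⟩
              x + (fromℤ m - suc k · g) - a              ≈⟨ +-congʳ (+-congˡ (+-congˡ (·-neg (suc k) g))) ⟨
              x + (fromℤ m + suc k · (- g)) - a          ∎)
          , <-by y<[1+k]g (begin
              suc k · g - (x - b + fromℤ m)      ≈⟨ solve 4 (λ y b x m →
                y :- (x :- b :+ m) := b :- (x :+ (m :- y))) refl (suc k · g) b x (fromℤ m) ⟩
              b - (x + (fromℤ m - suc k · g))    ≈⟨ +-congˡ (-‿cong (+-congˡ (+-congˡ (·-neg (suc k) g)))) ⟨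
              b - (x + (fromℤ m + suc k · (- g)))      ∎)

  -- Sums along words

  Σ< : (ℕ → Carrier) → ℕ → Carrier
  Σ< g zero    = 0#
  Σ< g (suc n) = Σ< g n + g n

  total : (Letter → Carrier) → List Letter → Carrier
  total w []       = 0#
  total w (x ∷ xs) = w x + total w xs

  opaque
    Σ<-cong : ∀ {g h} → (∀ n → g n ≈ h n) → ∀ n → Σ< g n ≈ Σ< h n
    Σ<-cong g≈h zero    = refl
    Σ<-cong g≈h (suc n) = +-cong (Σ<-cong g≈h n) (g≈h n)

    Σ<-+ : ∀ g m n → Σ< g (m ℕ.+ n) ≈ Σ< g m + Σ< (g ∘ (m ℕ.+_)) n
    Σ<-+ g m zero    = trans (reflexive (≡.cong (Σ< g) (ℕ.+-identityʳ m))) (sym (+-identityʳ _))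
    Σ<-+ g m (suc n) = begin
      Σ< g (m ℕ.+ suc n)                                      ≡⟨ ≡.cong (Σ< g) (ℕ.+-suc m n) ⟩
      Σ< g (m ℕ.+ n) + g (m ℕ.+ n)                            ≈⟨ +-congʳ (Σ<-+ g m n) ⟩
      (Σ< g m + Σ< (g ∘ (m ℕ.+_)) n) + g (m ℕ.+ n)            ≈⟨ +-assoc _ _ _ ⟩
      Σ< g m + (Σ< (g ∘ (m ℕ.+_)) n + g (m ℕ.+ n))            ∎

    Σ<-head : ∀ g n → Σ< g (suc n) ≈ g 0 + Σ< (g ∘ suc) n
    Σ<-head g n = trans (Σ<-+ g 1 n) (+-congʳ (+-identityˡ _))

    Σ<-prepend : ∀ w x xs W → Σ< (w ∘ prepend x xs W) (suc (length xs)) ≈ total w (x ∷ xs)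
    Σ<-prepend w x []       W = +-comm _ _
    Σ<-prepend w x (y ∷ ys) W = trans (Σ<-head (w ∘ prepend x (y ∷ ys) W) (suc (length ys)))
                                      (+-congˡ (Σ<-prepend w y ys W))

    prepend-drop : ∀ x xs W n → prepend x xs W (suc (length xs) ℕ.+ n) ≡ concat∞ W n
    prepend-drop x []       W zero    = ≡.refl
    prepend-drop x []       W (suc n) = ≡.refl
    prepend-drop x (y ∷ ys) W n       = prepend-drop y ys W n

    -- `N` is the length of the first `n` blocks, so sums of block totals form a subsequence of the
    -- sums over letters.
    Σ<-concat∞ : ∀ w W n → ∃[ N ] Σ< (w ∘ concat∞ W) N ≈ Σ< (λ i → total w (toList (W i))) n
    Σ<-concat∞ w W zero    = 0 , refl
    Σ<-concat∞ w W (suc n) = let N , eq = Σ<-concat∞ w (W ∘ suc) n in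
        k ℕ.+ N , (begin
        Σ< (w ∘ concat∞ W) (k ℕ.+ N)
          ≈⟨ Σ<-+ (w ∘ concat∞ W) k N ⟩
        Σ< (w ∘ concat∞ W) k + Σ< (λ i → w (concat∞ W (k ℕ.+ i))) N
          ≈⟨ +-cong (Σ<-prepend w (head (W 0)) (tail (W 0)) (W ∘ suc))
                    (Σ<-cong (λ i → reflexive (≡.cong w (prepend-drop (head (W 0)) (tail (W 0)) (W ∘ suc) i))) N) ⟩
        total w (toList (W 0)) + Σ< (w ∘ concat∞ (W ∘ suc)) N
          ≈⟨ +-congˡ eq ⟩
        total w (toList (W 0)) + Σ< (λ i → total w (toList (W (suc i)))) n
          ≈⟨ Σ<-head (λ i → total w (toList (W i))) n ⟨
        Σ< (λ i → total w (toList (W i))) (suc n)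
          ∎)
      where
      k : ℕ
      k = suc (length (tail (W 0)))

    toList-toList⁺ : ∀ xs (ne : xs ≢ []) → toList (toList⁺ xs ne) ≡ xs
    toList-toList⁺ []       ne = ⊥-elim (ne ≡.refl)
    toList-toList⁺ (x ∷ xs) ne = ≡.refl

  -- The Gottschalk-Hedlund argument.

  -- r is an orbit and F the sums along it of a function of the current point, both
  -- with locally constant increments to the right of each point.
  module RightContinuity (r F : ℕ → Carrier)
    (step : ∀ n → ∃[ h ] 0# < h × (∀ m → r n ≤ r m → r m < r n + h →
      r (suc m) - r (suc n) ≈ r m - r n × F (suc m) - F (suc n) ≈ F m - F n)) where

    module _ {e : Carrier} (0<e : 0# < e) where

      -- Failure of upper semicontinuity from the right, up to `e`, at `r n`, tested on later points
      -- of the orbit. The negated form is enough because it is only used to reach a contradiction.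
      Jumps : ℕ → Set
      Jumps n = ∀ h → 0# < h →
        ¬ (∀ d → r n ≤ r (n ℕ.+ d) → r (n ℕ.+ d) < r n + h → F (n ℕ.+ d) ≤ F n + e)

      opaque
        -- Just to the right of `r n` one step moves points and sums rigidly, so a good
        -- neighbourhood of `r (suc n)` pulls back to a good neighbourhood of `r n`.
        jumps-suc : ∀ {n} → Jumps n → Jumps (suc n)
        jumps-suc {n} jumps h 0<h small =
          let h₁ , 0<h₁ , shift = step n
              h₂ , 0<h₂ , h₂≤h , h₂≤h₁ = lowerBound 0<h 0<h₁
          in jumps h₂ 0<h₂ λ d r≤ r< →
            let eq-r , eq-F = shift (n ℕ.+ d) r≤ (<-≤-trans r< (≤-by h₂≤h₁
                  (solve 3 (λ a b x → a :- b := x :+ a :- (x :+ b)) refl h₁ h₂ (r n))))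
            in ≤-by (small d
                      (≤-by r≤ (sym eq-r))
                      (<-by (r< ⟨<+≤⟩ h₂≤h) (begin
                        r n + h₂ + h - (r (n ℕ.+ d) + h₂)
                          ≈⟨ solve 4 (λ x h₂ h y → x :+ h₂ :+ h :- (y :+ h₂) := h :- (y :- x)) refl _ _ _ _ ⟩
                        h - (r (n ℕ.+ d) - r n)
                          ≈⟨ +-congˡ (-‿cong eq-r) ⟨
                        h - (r (suc (n ℕ.+ d)) - r (suc n))
                          ≈⟨ solve 3 (λ x h y → h :- (y :- x) := x :+ h :- y) refl _ _ _ ⟩
                        r (suc n) + h - r (suc (n ℕ.+ d)) ∎)))
                    (begin
                      F (suc n) + e - F (suc (n ℕ.+ d))
                        ≈⟨ solve 3 (λ x e y → x :+ e :- y := e :- (y :- x)) refl _ _ _ ⟩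
                      e - (F (suc (n ℕ.+ d)) - F (suc n))
                        ≈⟨ +-congˡ (-‿cong eq-F) ⟩
                      e - (F (n ℕ.+ d) - F n)
                        ≈⟨ solve 3 (λ x e y → x :+ e :- y := e :- (y :- x)) refl _ _ _ ⟨
                      F n + e - F (n ℕ.+ d) ∎)

        jumps-+ : ∀ {n} d → Jumps n → Jumps (n ℕ.+ d)
        jumps-+ {n} zero    jumps = ≡.subst Jumps (≡.sym (ℕ.+-identityʳ n)) jumps
        jumps-+ {n} (suc d) jumps = ≡.subst Jumps (≡.sym (ℕ.+-suc n d)) (jumps-suc (jumps-+ d jumps))

        -- A jump leads to a later index at which `F` has grown by more than `e`, and by `jumps-+`
        -- that index jumps again. Iteration passes every bound.
        jumps-accumulate : ∀ j {n} → Jumps n → ¬ (∀ d → F (n ℕ.+ d) ≤ F n + j · e)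
        jumps-accumulate zero {n} jumps small = jumps 1# 0<1 λ d _ _ →
          ≤-by (small d ⟨≤+≤⟩ <⇒≤ 0<e)
            (solve 3 (λ x y e → x :+ con (+ 0) :+ e :- (y :+ con (+ 0)) := x :+ e :- y) refl _ _ _)
        jumps-accumulate (suc j) {n} jumps small = jumps 1# 0<1 λ d _ _ Fn+e<F →
          jumps-accumulate j (jumps-+ d jumps) λ d′ →
            ≤-by (≡.subst (λ k → F k ≤ F n + suc j · e) (≡.sym (ℕ.+-assoc n d d′)) (small (d ℕ.+ d′)) ⟨≤+≤⟩ <⇒≤ Fn+e<F)
              (solve 5 (λ x e z y w → x :+ (e :+ z) :+ y :- (w :+ (x :+ e)) := y :+ z :- w)
                refl (F n) e (j · e) (F (n ℕ.+ d)) (F (n ℕ.+ d ℕ.+ d′)))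

        bounded⇒¬jumps : ∀ {K} → (∀ n → F n ≤ K) → ¬ Jumps 0
        bounded⇒¬jumps {K} F≤K jumps =
          let j , _ , K-F0< = floor (≤-by (F≤K 0) (solve 2 (λ K x → K :- x := K :- x :- con (+ 0)) refl K (F 0))) 0<e
          in jumps-accumulate (suc j) jumps λ d → ≤-by (F≤K d ⟨≤+≤⟩ <⇒≤ K-F0<)
            (solve 4 (λ K x y z → K :+ x :- (z :+ (K :- y)) := y :+ x :- z) refl K (suc j · e) (F 0) (F d))

        -- This is the upper half of continuity from the right; the lower half comes from applying
        -- it to `- F`.
        right-continuous : ∀ {K} → (∀ n → F n ≤ K) →
          ¬ ¬ (∃[ h ] 0# < h × (∀ n → r 0 ≤ r n → r n < r 0 + h → F n ≤ F 0 + e))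
        right-continuous F≤K ¬small = bounded⇒¬jumps F≤K λ h 0<h small → ¬small (h , 0<h , small)

  -- Rotations of the circle

  module Rotation
    (ε l c : Carrier) (0<ε : 0# < ε) (ε<1 : ε < 1#) (ε<l : ε < l) (1-ε<l : 1# - ε < l)
    (l<1 : l < 1#) where

    open IntervalExchange ε l c

    -- The ends of `I B`. On the circle below, `q` is the only discontinuity of the rotation `R`; at
    -- `p` only the letter changes.
    p q : Carrier
    p = c + ε + l - 1#
    q = c + ε

    opaque
      c<p : c < p
      c<p = <-by 1-ε<l (solve 3 (λ c ε l →
        l :- (con (+ 1) :- ε) := c :+ ε :+ l :- con (+ 1) :- c) refl c ε l)

      p<q : p < q
      p<q = <-by l<1 (solve 3 (λ c ε l →
        con (+ 1) :- l := c :+ ε :- (c :+ ε :+ l :- con (+ 1))) refl c ε l)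

      q<c+1 : q < c + 1#
      q<c+1 = <-by ε<1 (solve 2 (λ c ε → con (+ 1) :- ε := c :+ con (+ 1) :- (c :+ ε)) refl c ε)

      piece-A : ∀ {x} → x < p → piece x ≡ A
      piece-A {x} x<p rewrite dec-true (x <? p) x<p = ≡.refl

      piece-B : ∀ {x} → p ≤ x → x < q → piece x ≡ B
      piece-B {x} p≤x x<q rewrite dec-false (x <? p) p≤x | dec-true (x <? q) x<q = ≡.refl

      piece-C : ∀ {x} → q ≤ x → piece x ≡ C
      piece-C {x} q≤x rewrite dec-false (x <? p) (λ x<p → q≤x (<-trans x<p p<q))
                            | dec-false (x <? q) q≤x = ≡.refl

    data Location (x : Carrier) : Set where
      in-A : x < p → Location x
      in-B : p ≤ x → x < q → Location x
      in-C : q ≤ x → Location x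

    locate : ∀ x → Location x
    locate x with <⊎≥ x p
    ... | inj₁ x<p = in-A x<p
    ... | inj₂ p≤x with <⊎≥ x q
    ... | inj₁ x<q = in-B p≤x x<q
    ... | inj₂ q≤x = in-C q≤x

    opaque
      I⇒piece : ∀ X {x} → I X x → piece x ≡ X
      I⇒piece A (_ , x<p)   = piece-A x<p
      I⇒piece B (p≤x , x<q) = piece-B p≤x x<q
      I⇒piece C (q≤x , _)   = piece-C q≤x

      piece-cong : ∀ {x y} → x ≈ y → piece x ≡ piece y
      piece-cong {x} {y} x≈y with locate x
      ... | in-A x<p     = ≡.trans (piece-A x<p) (≡.sym (piece-A (<-respˡ x≈y x<p)))
      ... | in-B p≤x x<q = ≡.trans (piece-B p≤x x<q)
                             (≡.sym (piece-B (≤-trans p≤x (≈⇒≤ x≈y)) (<-respˡ x≈y x<q)))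
      ... | in-C q≤x     = ≡.trans (piece-C q≤x) (≡.sym (piece-C (≤-trans q≤x (≈⇒≤ x≈y))))

      -- The pieces are closed on the left, so the letter is constant to the right of every point;
      -- constancy on both sides, in `piece-near`, requires avoiding `p` and `q`.
      piece-right : ∀ x → ∃[ h ] 0# < h × (∀ y → x ≤ y → y < x + h → piece y ≡ piece x)
      piece-right x with locate x
      ... | in-A x<p = p - x , x<y⇒0<y-x x<p , λ y x≤y y<p →
            ≡.trans (piece-A (<-respʳ (x+[y-x]≈y x p) y<p)) (≡.sym (piece-A x<p))
      ... | in-B p≤x x<q = q - x , x<y⇒0<y-x x<q , λ y x≤y y<q →
            ≡.trans (piece-B (≤-trans p≤x x≤y) (<-respʳ (x+[y-x]≈y x q) y<q)) (≡.sym (piece-B p≤x x<q))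
      ... | in-C q≤x = 1# , 0<1 , λ y x≤y _ → ≡.trans (piece-C (≤-trans q≤x x≤y)) (≡.sym (piece-C q≤x))

      piece-near : ∀ x → ¬ x ≈ p → ¬ x ≈ q →
        ∃[ h ] 0# < h × (∀ y → x - h < y → y < x + h → piece y ≡ piece x)
      piece-near x x≉p x≉q with piece-right x | locate x
      ... | h , 0<h , right | in-A x<p = h , 0<h , λ y _ y<x+h → case <⊎≥ y x of λ where
            (inj₁ y<x) → ≡.trans (piece-A (<-trans y<x x<p)) (≡.sym (piece-A x<p))
            (inj₂ x≤y) → right y x≤y y<x+h
      ... | h , 0<h , right | in-B p≤x x<q with ≤⇒<⊎≈ p≤x
      ... | inj₂ p≈x = ⊥-elim (x≉p (sym p≈x))
      ... | inj₁ p<x with lowerBound 0<h (x<y⇒0<y-x p<x)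
      ... | h′ , 0<h′ , h′≤h , h′≤x-p = h′ , 0<h′ , λ y x-h′<y y<x+h′ → case <⊎≥ y x of λ where
            (inj₁ y<x) → ≡.trans
              (piece-B (<⇒≤ (≤-<-trans (≤-by h′≤x-p (solve 3 (λ h x p → x :- p :- h := x :- h :- p) refl h′ x p)) x-h′<y))
                       (<-trans y<x x<q)) (≡.sym (piece-B p≤x x<q))
            (inj₂ x≤y) → right y x≤y (<-≤-trans y<x+h′
              (≤-by h′≤h (solve 3 (λ h h′ x → h :- h′ := x :+ h :- (x :+ h′)) refl h h′ x)))
      piece-near x x≉p x≉q | h , 0<h , right | in-C q≤x with ≤⇒<⊎≈ q≤x
      ... | inj₂ q≈x = ⊥-elim (x≉q (sym q≈x))
      ... | inj₁ q<x = x - q , x<y⇒0<y-x q<x , λ y x-[x-q]<y _ → ≡.trans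
            (piece-C (<⇒≤ (<-respˡ (solve 2 (λ x q → x :- (x :- q) := q) refl x q) x-[x-q]<y)))
            (≡.sym (piece-C q≤x))

    -- As A and B get the same value, `R` is the rotation by - ε of the circle `[ c , c + 1 ⟩`. The
    -- two letters are distinguished only by the weights summed along its orbits.
    rotation : Letter → Carrier
    rotation A = 1# - ε
    rotation B = 1# - ε
    rotation C = - ε

    R : Carrier → Carrier
    R x = x + rotation (piece x)

    infix 8 R^_

    R^_ : ℕ → Carrier → Carrier
    (R^ n) x = fold x R n

    Circle : Carrier → Set
    Circle x = x ∈[ c , c + 1# ⟩

    opaque
      R-cong : ∀ {x y} → x ≈ y → R x ≈ R y
      R-cong x≈y = +-cong x≈y (reflexive (≡.cong rotation (piece-cong x≈y)))

      R^-cong : ∀ n {x y} → x ≈ y → (R^ n) x ≈ (R^ n) y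
      R^-cong zero    x≈y = x≈y
      R^-cong (suc n) x≈y = R-cong (R^-cong n x≈y)

      R-low : ∀ {x} → x < q → R x ≈ x + (1# - ε)
      R-low {x} x<q with locate x
      ... | in-A x<p   = +-congˡ (reflexive (≡.cong rotation (piece-A x<p)))
      ... | in-B p≤x _ = +-congˡ (reflexive (≡.cong rotation (piece-B p≤x x<q)))
      ... | in-C q≤x   = ⊥-elim (q≤x x<q)

      R-high : ∀ {x} → q ≤ x → R x ≈ x - ε
      R-high q≤x = +-congˡ (reflexive (≡.cong rotation (piece-C q≤x)))

    opaque
      R-circle : ∀ {x} → Circle x → Circle (R x)
      R-circle {x} (c≤x , x<c+1) with <⊎≥ x q
      ... | inj₁ x<q =
          ≤-trans (≤-by (c≤x ⟨≤+≤⟩ <⇒≤ ε<1) (solve 3 (λ x c ε →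
            x :+ con (+ 1) :- (c :+ ε) := x :+ (con (+ 1) :- ε) :- c) refl x c ε)) (≈⇒≤ (sym (R-low x<q)))
        , <-respˡ (sym (R-low x<q)) (<-by x<q (solve 3 (λ x c ε →
            c :+ ε :- x := c :+ con (+ 1) :- (x :+ (con (+ 1) :- ε))) refl x c ε))
      ... | inj₂ q≤x =
          ≤-trans (≤-by q≤x (solve 3 (λ x c ε → x :- (c :+ ε) := x :- ε :- c) refl x c ε)) (≈⇒≤ (sym (R-high q≤x)))
        , <-respˡ (sym (R-high q≤x)) (<-by (x<c+1 ⟨<+<⟩ 0<ε) (solve 3 (λ x c ε →
            c :+ con (+ 1) :+ ε :- (x :+ con (+ 0)) := c :+ con (+ 1) :- (x :- ε)) refl x c ε))

      R^-circle : ∀ n {x} → Circle x → Circle ((R^ n) x)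
      R^-circle zero    x∈ = x∈
      R^-circle (suc n) x∈ = R-circle (R^-circle n x∈)

      R^-displacement : ∀ n x → ∃[ m ] (R^ n) x ≈ x + (fromℤ m - n · ε)
      R^-displacement zero    x = + 0 , solve 1 (λ x → x := x :+ (con (+ 0) :- con (+ 0))) refl x
      R^-displacement (suc n) x with R^-displacement n x | <⊎≥ ((R^ n) x) q
      ... | m , eq | inj₁ <q = m ℤ.+ + 1 , (begin
        R ((R^ n) x)                                        ≈⟨ R-low <q ⟩
        (R^ n) x + (1# - ε)                                 ≈⟨ +-congʳ eq ⟩
        x + (fromℤ m - n · ε) + (1# - ε)                    ≈⟨ solve 4 (λ x m n ε →
          x :+ (m :- n) :+ (con (+ 1) :- ε) := x :+ (m :+ (con (+ 1) :+ con (+ 0)) :- (ε :+ n))) refl _ _ _ _ ⟩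
        x + (fromℤ m + fromℤ (+ 1) - suc n · ε)             ≈⟨ +-congˡ (+-congʳ (fromℤ-+ m (+ 1))) ⟨
        x + (fromℤ (m ℤ.+ + 1) - suc n · ε)                 ∎)
      ... | m , eq | inj₂ q≤ = m , (begin
        R ((R^ n) x)                      ≈⟨ R-high q≤ ⟩
        (R^ n) x - ε                      ≈⟨ +-congʳ eq ⟩
        x + (fromℤ m - n · ε) - ε         ≈⟨ solve 4 (λ x m n ε →
          x :+ (m :- n) :- ε := x :+ (m :- (ε :+ n))) refl _ _ _ _ ⟩
        x + (fromℤ m - suc n · ε)         ∎)

      fromℤ-small : ∀ m → - 1# < fromℤ m → fromℤ m < 1# → fromℤ m ≈ 0#
      fromℤ-small (+ zero)  _  _  = refl
      fromℤ-small (+ suc n) _ <1 = ⊥-elim (0≤n·1 n (<-by <1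
        (solve 1 (λ x → con (+ 1) :- (con (+ 1) :+ x) := con (+ 0) :- x) refl (n · 1#))))
      fromℤ-small -[1+ n ] -1< _ = ⊥-elim (0≤n·1 n (<-by -1<
        (solve 1 (λ x → :- (con (+ 1) :+ x) :- :- con (+ 1) := con (+ 0) :- x) refl (n · 1#))))

      -- The point reached differs from `y` by an integer, and both lie in one half-open interval of
      -- length 1.
      R^-reaches : ∀ {x y m n} → Circle x → Circle y → y ≈ x + (fromℤ m - n · ε) → (R^ n) x ≈ y
      R^-reaches {x} {y} {m} {n} x∈ (c≤y , y<c+1) y≈ =
        let m′ , eq       = R^-displacement n x
            c≤z , z<c+1   = R^-circle n x∈
            z-y : (R^ n) x - y ≈ fromℤ (m′ ℤ.- m)
            z-y = begin
              (R^ n) x - y                                              ≈⟨ +-cong eq (-‿cong y≈) ⟩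
              x + (fromℤ m′ - n · ε) - (x + (fromℤ m - n · ε))          ≈⟨ solve 4 (λ x m′ n m →
                x :+ (m′ :- n) :- (x :+ (m :- n)) := m′ :- m) refl _ _ _ _ ⟩
              fromℤ m′ - fromℤ m                                        ≈⟨ +-congˡ (fromℤ-neg m) ⟨
              fromℤ m′ + fromℤ (ℤ.- m)                                  ≈⟨ fromℤ-+ m′ (ℤ.- m) ⟨
              fromℤ (m′ ℤ.- m)                                          ∎
            z-y≈0 = fromℤ-small (m′ ℤ.- m)
              (<-respʳ z-y (<-by (c≤z ⟨≤+<⟩ y<c+1) (solve 3 (λ z y c →
                z :+ (c :+ con (+ 1)) :- (c :+ y) := z :- y :- :- con (+ 1)) refl _ _ _)))
              (<-respˡ z-y (<-by (c≤y ⟨≤+<⟩ z<c+1) (solve 3 (λ z y c →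
                y :+ (c :+ con (+ 1)) :- (c :+ z) := con (+ 1) :- (z :- y)) refl _ _ _)))
        in begin
          (R^ n) x              ≈⟨ solve 2 (λ z y → z := y :+ (z :- y)) refl _ y ⟩
          y + ((R^ n) x - y)    ≈⟨ +-congˡ (trans z-y z-y≈0) ⟩
          y + 0#                ≈⟨ +-identityʳ y ⟩
          y                     ∎

    -- Away from the discontinuities p and q an orbit segment can be moved rigidly.
    module _ (w : Letter → Carrier) where

      sum-along : Carrier → ℕ → Carrier
      sum-along x = Σ< (λ i → w (piece ((R^ i) x)))

      opaque
        rigid : ∀ x n → (∀ k → k ℕ.< n → ¬ (R^ k) x ≈ p × ¬ (R^ k) x ≈ q) →
          ∃[ h ] 0# < h × (∀ y → x - h < y → y < x + h →
            (R^ n) y ≈ (R^ n) x + (y - x) × sum-along y n ≈ sum-along x n)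
        rigid x zero    avoids = 1# , 0<1 , λ y _ _ → sym (x+[y-x]≈y x y) , refl
        rigid x (suc n) avoids =
          let h₁ , 0<h₁ , moved = rigid x n (λ k k<n → avoids k (ℕ.m<n⇒m<1+n k<n))
              z≉p , z≉q = avoids n ℕ.≤-refl
              h₂ , 0<h₂ , near = piece-near ((R^ n) x) z≉p z≉q
              h , 0<h , h≤h₁ , h≤h₂ = lowerBound 0<h₁ 0<h₂
          in h , 0<h , λ y x-h<y y<x+h →
            let eq , sum-eq = moved y
                  (<-by (x-h<y ⟨<+≤⟩ h≤h₁) (solve 4 (λ x h y h₁ → y :+ h₁ :- (x :- h :+ h) := y :- (x :- h₁)) refl _ _ _ _))
                  (<-by (y<x+h ⟨<+≤⟩ h≤h₁) (solve 4 (λ x h y h₁ → x :+ h :+ h₁ :- (y :+ h) := x :+ h₁ :- y) refl _ _ _ _))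
                same = near ((R^ n) y)
                  (<-respʳ (sym eq) (<-by (x-h<y ⟨<+≤⟩ h≤h₂) (solve 5 (λ z x h y h₂ →
                    y :+ h₂ :- (x :- h :+ h) := z :+ (y :- x) :- (z :- h₂)) refl _ _ _ _ _)))
                  (<-respˡ (sym eq) (<-by (y<x+h ⟨<+≤⟩ h≤h₂) (solve 5 (λ z x h y h₂ →
                    x :+ h :+ h₂ :- (y :+ h) := z :+ h₂ :- (z :+ (y :- x))) refl _ _ _ _ _)))
            in (begin
                (R^ n) y + rotation (piece ((R^ n) y))              ≡⟨ ≡.cong (λ X → (R^ n) y + rotation X) same ⟩
                (R^ n) y + rotation (piece ((R^ n) x))              ≈⟨ +-congʳ eq ⟩
                (R^ n) x + (y - x) + rotation (piece ((R^ n) x))    ≈⟨ solve 3 (λ z d t → z :+ d :+ t := z :+ t :+ d) refl _ _ _ ⟩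
                (R^ n) x + rotation (piece ((R^ n) x)) + (y - x)    ∎)
              , +-cong sum-eq (reflexive (≡.cong w same))

  -- Kesten's theorem

  -- A nested product, so that families of bounds can be written and matched as tuples.
  Each : (Carrier → Set) → List Carrier → Set
  Each P []       = ⊤
  Each P (x ∷ xs) = P x × Each P xs

  lowerBounds : ∀ xs → Each (0# <_) xs → ∃[ h ] 0# < h × Each (h ≤_) xs
  lowerBounds []       _          = 1# , 0<1 , _
  lowerBounds (x ∷ xs) (0<x , ps) =
    let h′ , 0<h′ , h′≤ = lowerBounds xs ps
        h , 0<h , h≤x , h≤h′ = lowerBound 0<x 0<h′
    in h , 0<h , h≤x , weaken xs h≤h′ h′≤
    where
    weaken : ∀ xs {h h′} → h ≤ h′ → Each (h′ ≤_) xs → Each (h ≤_) xs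
    weaken []       _    _          = _
    weaken (x ∷ xs) h≤h′ (h′≤x , ps) = ≤-trans h≤h′ h′≤x , weaken xs h≤h′ ps

  5# : Carrier
  5# = 1# + 1# + 1# + 1# + 1#

  opaque
    0<5 : 0# < 5#
    0<5 = <-by (0<1 ⟨<+<⟩ 0<1 ⟨<+<⟩ 0<1 ⟨<+<⟩ 0<1 ⟨<+<⟩ 0<1) (+-congˡ (-‿cong
      (solve 0 (con (+ 0) :+ con (+ 0) :+ con (+ 0) :+ con (+ 0) :+ con (+ 0) := con (+ 0)) refl)))

  module BoundedRemainder
    (ε l c : Carrier) (0<ε : 0# < ε) (ε<1 : ε < 1#) (ε<l : ε < l) (1-ε<l : 1# - ε < l)
    (l<1 : l < 1#) (c≤0 : c ≤ 0#) (0<c+1 : 0# < c + 1#)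
    (irrational : Irrational ε) (l∉ : ¬ (l ∈ℤ+ℤ ε)) where

    open IntervalExchange ε l c
    open Rotation ε l c 0<ε ε<1 ε<l 1-ε<l l<1

    opaque
      p-circle : Circle p
      p-circle = <⇒≤ c<p , <-trans p<q q<c+1

      -- A period n + 1 would make (n + 1) ε an integer.
      aperiodic : ∀ n {x} → ¬ (R^ suc n) x ≈ x
      aperiodic n {x} Rx≈x =
        let m , eq = R^-displacement (suc n) x
        in irrational (m , + suc n , (λ ()) , (begin
          fromℤ (+ suc n) * ε                        ≈⟨ fromℤ-·1 (suc n) ε ⟩
          suc n · ε                                  ≈⟨ solve 3 (λ x m y → y := x :+ m :- (x :+ (m :- y))) refl x (fromℤ m) _ ⟩
          x + fromℤ m - (x + (fromℤ m - suc n · ε))  ≈⟨ +-congˡ (-‿cong (trans (sym eq) Rx≈x)) ⟩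
          x + fromℤ m - x                            ≈⟨ solve 2 (λ x m → x :+ m :- x := m) refl x (fromℤ m) ⟩
          fromℤ m                                    ∎))

      -- The difference p - q is l - 1, so a common orbit would put l into ℤ + ℤε. This is where
      -- `l∉` enters.
      p-q-not-in-one-orbit : ∀ {x} m n → (R^ m) x ≈ p → ¬ (R^ n) x ≈ q
      p-q-not-in-one-orbit {x} m n ≈p ≈q =
        let i , eqᵢ = R^-displacement m x
            j , eqⱼ = R^-displacement n x
        in l∉ (∈ℤ+ℤ-resp (begin
          (fromℤ i - m · ε) - (fromℤ j - n · ε) + 1#            ≈⟨ solve 3 (λ x i j →
            i :- j :+ con (+ 1) := x :+ i :- (x :+ j) :+ con (+ 1)) refl x _ _ ⟩
          x + (fromℤ i - m · ε) - (x + (fromℤ j - n · ε)) + 1#  ≈⟨ +-congʳ (+-cong (trans (sym eqᵢ) ≈p) (-‿cong (trans (sym eqⱼ) ≈q))) ⟩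
          p - q + 1#                                            ≈⟨ solve 3 (λ c ε l →
            c :+ ε :+ l :- con (+ 1) :- (c :+ ε) :+ con (+ 1) := l) refl c ε l ⟩
          l                                                     ∎)
          (∈ℤ+ℤ-+ (∈ℤ+ℤ-+ (Displacement⇒∈ℤ+ℤ (i , m , refl))
                          (∈ℤ+ℤ-neg (Displacement⇒∈ℤ+ℤ (j , n , refl)))) 1∈ℤ+ℤ))

      R^-+ : ∀ m n {x} → (R^ (m ℕ.+ n)) x ≡ (R^ m) ((R^ n) x)
      R^-+ m n {x} = fold-+ x R m

      -- By aperiodicity an orbit meets `p` at most once, and it never meets both `p` and `q`. Hence
      -- `rigid` applies up to the arrival at `p` and, by `after-p`, ever after.
      before-p : ∀ {z} j → (R^ j) z ≈ p → ∀ k → k ℕ.< j → ¬ (R^ k) z ≈ p × ¬ (R^ k) z ≈ q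
      before-p {z} j z→p k k<j = z↛p , p-q-not-in-one-orbit j k z→p
        where
        z↛p : ¬ (R^ k) z ≈ p
        z↛p z→p′ = let i , j≡ = ℕ.m≤n⇒∃[o]m+o≡n k<j in
          aperiodic i (begin
            (R^ suc i) p             ≈⟨ R^-cong (suc i) z→p′ ⟨
            (R^ suc i) ((R^ k) z)    ≡⟨ ≡.sym (R^-+ (suc i) k) ⟩
            (R^ (suc i ℕ.+ k)) z     ≡⟨ ≡.cong (λ n → (R^ n) z) (≡.trans (≡.cong suc (ℕ.+-comm i k)) j≡) ⟩
            (R^ j) z                 ≈⟨ z→p ⟩
            p                        ∎)

      after-p : ∀ i k → k ℕ.< i → ¬ (R^ k) (R p) ≈ p × ¬ (R^ k) (R p) ≈ q
      after-p _ k _ =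
          (λ Rp→p → aperiodic k (trans (reflexive Rp-shift) Rp→p))
        , (λ Rp→q → p-q-not-in-one-orbit 0 (suc k) refl (trans (reflexive Rp-shift) Rp→q))
        where
        Rp-shift : (R^ suc k) p ≡ (R^ k) (R p)
        Rp-shift = ≡.trans (≡.cong (λ n → (R^ n) p) (ℕ.+-comm 1 k)) (R^-+ k 1)

    opaque
      -- Minimality of the rotation: `dense` finds a displacement into the interval, and
      -- `R^-reaches` realizes it by iterating `R`.
      visit : ∀ {x a b} → Circle x → c ≤ a → b ≤ c + 1# → a < b →
        ∃[ n ] a < (R^ n) x × (R^ n) x < b
      visit {x} x∈ c≤a b≤c+1 a<b =
        let d , (m , n , eq) , a<x+d , x+d<b = dense 0<ε irrational x a<b
            reach = R^-reaches {m = m} {n = n} x∈ (<⇒≤ (≤-<-trans c≤a a<x+d) , <-≤-trans x+d<b b≤c+1) (+-congˡ eq)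
        in n , <-respʳ (sym reach) a<x+d , <-respˡ (sym reach) x+d<b

    module _ (w : Letter → Carrier) where

      opaque
        -- The cocycle identity of Birkhoff sums.
        sum-along-+ : ∀ x m n → sum-along w x (m ℕ.+ n) ≈ sum-along w x n + sum-along w ((R^ n) x) m
        sum-along-+ x zero    n = sym (+-identityʳ _)
        sum-along-+ x (suc m) n = trans
          (+-cong (sum-along-+ x m n) (reflexive (≡.cong (w ∘ piece) (R^-+ m n))))
          (+-assoc _ _ _)

      r F : ℕ → Carrier
      r n = (R^ n) 0#
      F n = sum-along w 0# n

      opaque
        step : ∀ n → ∃[ h ] 0# < h × (∀ m → r n ≤ r m → r m < r n + h →
          r (suc m) - r (suc n) ≈ r m - r n × F (suc m) - F (suc n) ≈ F m - F n)
        step n =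
          let h , 0<h , same = piece-right (r n)
          in h , 0<h , λ m r≤ r< → let eq = same (r m) r≤ r< in cancel rotation eq , cancel w eq
          where
          cancel : ∀ (v : Letter → Carrier) {x y a b} → piece x ≡ piece y →
            (a + v (piece x)) - (b + v (piece y)) ≈ a - b
          cancel v {x} {y} {a} {b} eq rewrite eq =
            solve 3 (λ a b v → a :+ v :- (b :+ v) := a :- b) refl a b (v (piece y))

        step⁻ : ∀ n → ∃[ h ] 0# < h × (∀ m → r n ≤ r m → r m < r n + h →
          r (suc m) - r (suc n) ≈ r m - r n × - F (suc m) - - F (suc n) ≈ - F m - - F n)
        step⁻ n =
          let h , 0<h , shift = step n
          in h , 0<h , λ m r≤ r< → let eq-r , eq-F = shift m r≤ r< in
            eq-r , (begin
              - F (suc m) - - F (suc n)  ≈⟨ neg-diff _ _ ⟩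
              - (F (suc m) - F (suc n))  ≈⟨ -‿cong eq-F ⟩
              - (F m - F n)              ≈⟨ neg-diff _ _ ⟨
              - F m - - F n              ∎)
          where
          neg-diff : ∀ x y → - x - - y ≈ - (x - y)
          neg-diff = solve 2 (λ x y → :- x :- :- y := :- (x :- y)) refl

      module _ {h e : Carrier} (0<h : 0# < h)
        (small : ∀ n → 0# ≤ r n → r n < h → F n ≤ e × - F n ≤ e) where

        -- The bound is 2e because it is applied to differences of two values of `F`, each at most
        -- `e` in absolute value.
        Bounded : Carrier → Set
        Bounded x = x ≤ e + e × - x ≤ e + e

        -- A short segment near 0 that is carried over p, but never over q, before it
        -- returns near 0, changes the difference of F between its endpoints by w B - w A.
        module _ {z} j i (z→p : (R^ j) z ≈ p) (0<z : 0# < z) (z<h : z < h)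
          (0<z′ : 0# < (R^ i) (R p)) (z′<h : (R^ i) (R p) < h) where

          opaque
            crossing : ∃[ S ] ∃[ η ] 0# < η × η ≤ z × η ≤ h - z ×
              (∀ n → z - η < r n → r n < z + η →
                (r n < z → Bounded (w A + S)) × (z ≤ r n → Bounded (w B + S)))
            crossing with rigid w z j (before-p j z→p) | rigid w (R p) i (after-p i)
            ... | h₁ , 0<h₁ , moved₁ | h₂ , 0<h₂ , moved₂
              -- The bounds `h₁` and `h₂` keep both orbit segments rigid, `q - p` keeps the passage
              -- near `p` short of `q`, and the last four keep the start and the return in
              -- `[0 , h⟩`.
              with lowerBounds (h₁ ∷ h₂ ∷ q - p ∷ z ∷ h - z ∷ (R^ i) (R p) ∷ h - (R^ i) (R p) ∷ [])
                     (0<h₁ , 0<h₂ , x<y⇒0<y-x p<q , 0<z , x<y⇒0<y-x z<h , 0<z′ , x<y⇒0<y-x z′<h , _)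
            ... | η , 0<η , η≤h₁ , η≤h₂ , η≤q-p , η≤z , η≤h-z , η≤z′ , η≤h-z′ , _ =
              S , η , 0<η , η≤z , η≤h-z , sides
              where
              S : Carrier
              S = sum-along w z j + sum-along w (R p) i

              module At n (z-η<y : z - η < r n) (y<z+η : r n < z + η) where
                y y′ : Carrier
                y  = r n
                y′ = R ((R^ j) y)

                moved-y : (R^ j) y ≈ (R^ j) z + (y - z) × sum-along w y j ≈ sum-along w z j
                moved-y = moved₁ y
                  (<-by (z-η<y ⟨<+≤⟩ η≤h₁) (solve 4 (λ z η y h → y :+ h :- (z :- η :+ η) := y :- (z :- h)) refl z η y h₁))
                  (<-by (y<z+η ⟨<+≤⟩ η≤h₁) (solve 4 (λ z η y h → z :+ η :+ h :- (y :+ η) := z :+ h :- y) refl z η y h₁))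

                y→p : (R^ j) y ≈ p + (y - z)
                y→p = trans (proj₁ moved-y) (+-congʳ z→p)

                <q : (R^ j) y < q
                <q = <-respˡ (sym y→p) (<-by (y<z+η ⟨<+≤⟩ η≤q-p) (solve 5 (λ z η y p q →
                  z :+ η :+ (q :- p) :- (y :+ η) := q :- (p :+ (y :- z))) refl z η y p q))

                y→Rp : y′ ≈ R p + (y - z)
                y→Rp = begin
                  R ((R^ j) y)               ≈⟨ R-low <q ⟩
                  (R^ j) y + (1# - ε)        ≈⟨ +-congʳ y→p ⟩
                  p + (y - z) + (1# - ε)     ≈⟨ solve 3 (λ p d v → p :+ d :+ v := p :+ v :+ d) refl p (y - z) (1# - ε) ⟩
                  p + (1# - ε) + (y - z)     ≈⟨ +-congʳ (R-low p<q) ⟨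
                  R p + (y - z)              ∎

                moved-y′ : (R^ i) y′ ≈ (R^ i) (R p) + (y′ - R p) × sum-along w y′ i ≈ sum-along w (R p) i
                moved-y′ = moved₂ y′
                  (<-respʳ (sym y→Rp) (<-by (z-η<y ⟨<+≤⟩ η≤h₂) (solve 5 (λ z η y h x →
                    y :+ h :- (z :- η :+ η) := x :+ (y :- z) :- (x :- h)) refl z η y h₂ (R p))))
                  (<-respˡ (sym y→Rp) (<-by (y<z+η ⟨<+≤⟩ η≤h₂) (solve 5 (λ z η y h x →
                    z :+ η :+ h :- (y :+ η) := x :+ h :- (x :+ (y :- z))) refl z η y h₂ (R p))))

                -- From index `n`: `j` steps to the neighbourhood of `p`, one step whose letter
                -- depends on the side of `p`, and `i` steps back to the neighbourhood of 0.
                N : ℕ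
                N = i ℕ.+ suc (j ℕ.+ n)

                rN : r N ≈ (R^ i) (R p) + (y - z)
                rN = begin
                  r N                                    ≡⟨ R^-+ i (suc (j ℕ.+ n)) ⟩
                  (R^ i) (R (r (j ℕ.+ n)))               ≡⟨ ≡.cong ((R^ i) ∘ R) (R^-+ j n) ⟩
                  (R^ i) y′                              ≈⟨ proj₁ moved-y′ ⟩
                  (R^ i) (R p) + (y′ - R p)              ≈⟨ +-congˡ (+-congʳ y→Rp) ⟩
                  (R^ i) (R p) + (R p + (y - z) - R p)   ≈⟨ solve 3 (λ x y d → x :+ (y :+ d :- y) := x :+ d) refl ((R^ i) (R p)) (R p) (y - z) ⟩
                  (R^ i) (R p) + (y - z)                 ∎

                FN : ∀ X → piece ((R^ j) y) ≡ X → F N - F n ≈ w X + S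
                FN X eq = begin
                  F N - F n
                    ≈⟨ +-congʳ (sum-along-+ 0# i (suc (j ℕ.+ n))) ⟩
                  F (j ℕ.+ n) + w (piece (r (j ℕ.+ n))) + sum-along w (R (r (j ℕ.+ n))) i - F n
                    ≡⟨ ≡.cong (λ x → F (j ℕ.+ n) + w (piece x) + sum-along w (R x) i - F n) (R^-+ j n) ⟩
                  F (j ℕ.+ n) + w (piece ((R^ j) y)) + sum-along w y′ i - F n
                    ≈⟨ +-congʳ (+-cong (+-cong (trans (sum-along-+ 0# j n) (+-congˡ (proj₂ moved-y)))
                                               (reflexive (≡.cong w eq))) (proj₂ moved-y′)) ⟩
                  F n + sum-along w z j + w X + sum-along w (R p) i - F n
                    ≈⟨ solve 4 (λ f s v t → f :+ s :+ v :+ t :- f := v :+ (s :+ t)) refl (F n) _ (w X) _ ⟩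
                  w X + S
                    ∎

                at-n : F n ≤ e × - F n ≤ e
                at-n = small n
                  (≤-by (<⇒≤ z-η<y ⟨≤+≤⟩ η≤z) (solve 3 (λ z η y → y :+ z :- (z :- η :+ η) := y :- con (+ 0)) refl z η y))
                  (<-by (y<z+η ⟨<+≤⟩ η≤h-z) (solve 4 (λ z η y h → z :+ η :+ (h :- z) :- (y :+ η) := h :- y) refl z η y h))

                at-N : F N ≤ e × - F N ≤ e
                at-N = small N
                  (≤-trans (≤-by (<⇒≤ z-η<y ⟨≤+≤⟩ η≤z′) (solve 4 (λ z η y x →
                    y :+ x :- (z :- η :+ η) := x :+ (y :- z) :- con (+ 0)) refl z η y ((R^ i) (R p)))) (≈⇒≤ (sym rN)))
                  (<-respˡ (sym rN) (<-by (y<z+η ⟨<+≤⟩ η≤h-z′) (solve 5 (λ z η y h x →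
                    z :+ η :+ (h :- x) :- (y :+ η) := h :- (x :+ (y :- z))) refl z η y h ((R^ i) (R p)))))

                bounded : ∀ X → piece ((R^ j) y) ≡ X → Bounded (w X + S)
                bounded X eq =
                    ≤-trans (≈⇒≤ (sym (FN X eq))) (proj₁ at-N ⟨≤+≤⟩ proj₂ at-n)
                  , ≤-trans (≈⇒≤ (trans (-‿cong (sym (FN X eq))) (solve 2 (λ x y → :- (x :- y) := :- x :+ y) refl (F N) (F n))))
                            (proj₂ at-N ⟨≤+≤⟩ proj₁ at-n)

              sides : ∀ n → z - η < r n → r n < z + η →
                (r n < z → Bounded (w A + S)) × (z ≤ r n → Bounded (w B + S))
              sides n z-η<y y<z+η =
                  (λ y<z → bounded A (piece-A (<-respˡ (sym y→p)
                     (<-by y<z (solve 3 (λ y z p → z :- y := p :- (p :+ (y :- z))) refl y z p)))))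
                , (λ z≤y → bounded B (piece-B (≤-trans
                     (≤-by z≤y (solve 3 (λ y z p → y :- z := p :+ (y :- z) :- p) refl y z p)) (≈⇒≤ (sym y→p))) <q))
                where open At n z-η<y y<z+η

        opaque
          -- The backward orbit of `p` is dense. Instead of inverting `R`, a displacement `d` with
          -- `- p + d` between `- h₀` and 0 is taken, and z = p - d.
          pivot : ∀ {h₀} → 0# < h₀ → h₀ ≤ c + 1# → ∃[ z ] ∃[ j ] 0# < z × z < h₀ × (R^ j) z ≈ p
          pivot {h₀} 0<h₀ h₀≤c+1 with dense 0<ε irrational (- p) (0<x⇒-x<0 0<h₀)
          ... | d , (m , j , d≈) , -h₀<d-p , d-p<0 = p - d , j , 0<z , z<h₀
              , R^-reaches {m = m} {n = j} (≤-trans c≤0 (<⇒≤ 0<z) , <-≤-trans z<h₀ h₀≤c+1) p-circle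
                  (trans (solve 2 (λ p d → p := p :- d :+ d) refl p d) (+-congˡ d≈))
            where
            0<z : 0# < p - d
            0<z = <-by d-p<0 (solve 2 (λ p d → con (+ 0) :- (:- p :+ d) := p :- d :- con (+ 0)) refl p d)

            z<h₀ : p - d < h₀
            z<h₀ = <-by -h₀<d-p (solve 3 (λ p d h → :- p :+ d :- :- h := h :- (p :- d)) refl p d h₀)

        opaque
          -- The points `z` and `i` describe a passage from near 0 through `p` and back. The orbit
          -- of 0 visits both sides of `z` closely; subtracting the two resulting bounds eliminates
          -- `S` and leaves w B - w A, at the cost of 2e for each side.
          jump-at-p : w B - w A ≤ e + e + (e + e) × - (w B - w A) ≤ e + e + (e + e)
          jump-at-p with lowerBound 0<h 0<c+1
          ... | h₀ , 0<h₀ , h₀≤h , h₀≤c+1 with pivot 0<h₀ h₀≤c+1 | visit (R-circle p-circle) c≤0 h₀≤c+1 0<h₀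
          ... | z , j , 0<z , z<h₀ , z→p | i , 0<z′ , z′<h₀
            with crossing j i z→p 0<z (<-≤-trans z<h₀ h₀≤h) 0<z′ (<-≤-trans z′<h₀ h₀≤h)
               | lowerBound (x<y⇒0<y-x z<h₀) 0<1
          ... | S , η , 0<η , η≤z , η≤h-z , crossed | k , 0<k , k≤h₀-z , _ with lowerBound 0<η 0<k
          ... | κ , 0<κ , κ≤η , κ≤k =
              ≤-by (proj₁ at-b ⟨≤+≤⟩ proj₂ at-a)
                (solve 4 (λ a b s e → e :- (b :+ s :+ :- (a :+ s)) := e :- (b :- a)) refl (w A) (w B) S _)
            , ≤-by (proj₁ at-a ⟨≤+≤⟩ proj₂ at-b)
                (solve 4 (λ a b s e → e :- (a :+ s :+ :- (b :+ s)) := e :- :- (b :- a)) refl (w A) (w B) S _)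
            where
            z<z+κ : z < z + κ
            z<z+κ = <-by 0<κ (solve 2 (λ z k → k :- con (+ 0) := z :+ k :- z) refl z κ)

            z+κ≤z+η : z + κ ≤ z + η
            z+κ≤z+η = ≤-by κ≤η (solve 3 (λ z k h → h :- k := z :+ h :- (z :+ k)) refl z κ η)

            at-a : Bounded (w A + S)
            at-a with visit (c≤0 , 0<c+1)
                        (≤-trans c≤0 (≤-by η≤z (solve 2 (λ z k → z :- k := z :- k :- con (+ 0)) refl z η)))
                        (<⇒≤ (<-≤-trans z<h₀ h₀≤c+1)) (x-y<x 0<η)
            ... | a , z-η<ra , ra<z = proj₁ (crossed a z-η<ra (<-≤-trans (<-trans ra<z z<z+κ) z+κ≤z+η)) ra<z

            at-b : Bounded (w B + S)
            at-b with visit (c≤0 , 0<c+1) (≤-trans c≤0 (<⇒≤ 0<z))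
                        (≤-trans (≤-by (≤-trans κ≤k k≤h₀-z) (solve 3 (λ z k h → h :- z :- k := h :- (z :+ k)) refl z κ h₀)) h₀≤c+1)
                        z<z+κ
            ... | b , z<rb , rb<z+κ = proj₂ (crossed b (<-trans (x-y<x 0<η) z<rb) (<-≤-trans rb<z+κ z+κ≤z+η)) (<⇒≤ z<rb)

      opaque
        -- Here `x` plays the absolute value of w B - w A, described by the bounds it satisfies so
        -- that both signs share one proof. Continuity from the right at 0, for `F` and for `- F`,
        -- provides the interval on which `jump-at-p` applies.
        no-jump-above : ∀ {K x} → (∀ n → F n ≤ K × - F n ≤ K) → 0# < x →
          (∀ {y} → w B - w A ≤ y → - (w B - w A) ≤ y → x ≤ y) → ⊥
        no-jump-above {K} {x} F-bounded 0<x x-least with positive-inverse 0<5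
        ... | y , 0<y , 5y≈1 =
          RightContinuity.right-continuous r F step 0<e (proj₁ ∘ F-bounded) λ (h₁ , 0<h₁ , F≤) →
          RightContinuity.right-continuous r (-_ ∘ F) step⁻ 0<e (proj₂ ∘ F-bounded) λ (h₂ , 0<h₂ , -F≤) →
          let h , 0<h , h≤h₁ , h≤h₂ = lowerBound 0<h₁ 0<h₂
              J≤ , -J≤ = jump-at-p {h} {e} 0<h λ n 0≤r r<h →
                  ≤-trans (F≤ n 0≤r (<-respʳ (sym (+-identityˡ h₁)) (<-≤-trans r<h h≤h₁))) (≈⇒≤ (+-identityˡ e))
                , ≤-trans (-F≤ n 0≤r (<-respʳ (sym (+-identityˡ h₂)) (<-≤-trans r<h h≤h₂)))
                    (≈⇒≤ (solve 1 (λ e → :- con (+ 0) :+ e := e) refl e))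
          in x-least J≤ -J≤ (<-by 0<e (begin
            e - 0#                          ≈⟨ solve 2 (λ x y → x :* y :- con (+ 0) :=
              x :* ((con (+ 1) :+ con (+ 1) :+ con (+ 1) :+ con (+ 1) :+ con (+ 1)) :* y)
                :- (x :* y :+ x :* y :+ (x :* y :+ x :* y))) refl x y ⟩
            x * (5# * y) - (e + e + (e + e))
                                            ≈⟨ +-congʳ (*-congˡ 5y≈1) ⟩
            x * 1# - (e + e + (e + e))      ≈⟨ +-congʳ (*-identityʳ x) ⟩
            x - (e + e + (e + e))           ∎))
          where
          -- As y = 1/5, this is x / 5, and the bound 4e on the jump falls below `x`.
          e : Carrier
          e = x * y

          0<e : 0# < e
          0<e = *-pos 0<x 0<y

        -- Kesten's theorem for the interval [ p , q ⟩: as l ∉ ℤ + ℤε, its visits have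
        -- unbounded discrepancy, and so must not contribute to F.
        bounded⇒no-jump : ∀ {K} → (∀ n → F n ≤ K × - F n ≤ K) → w B ≈ w A
        bounded⇒no-jump F-bounded with compare (w A) (w B)
        ... | tri≈ _ wA≈wB _ = sym wA≈wB
        ... | tri< wA<wB _ _ = ⊥-elim (no-jump-above F-bounded (x<y⇒0<y-x wA<wB) λ ≤y _ → ≤y)
        ... | tri> _ _ wB<wA = ⊥-elim (no-jump-above F-bounded (x<y⇒0<y-x wB<wA) λ _ →
                ≤-trans (≈⇒≤ (solve 2 (λ a b → a :- b := :- (b :- a)) refl (w A) (w B))))

  -- Estimates for products and for sums of sequences.

  opaque
    absolute : ∀ x → ∃[ a ] 0# ≤ a × x ≤ a × - x ≤ a
    absolute x with <⊎≥ x 0#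
    ... | inj₁ x<0 = - x , <⇒≤ (x<0⇒0<-x x<0) , <⇒≤ (<-trans x<0 (x<0⇒0<-x x<0)) , ≈⇒≤ refl
    ... | inj₂ 0≤x = x , 0≤x , ≈⇒≤ refl
        , ≤-by (0≤x ⟨≤+≤⟩ 0≤x) (solve 1 (λ x → x :+ x :- (con (+ 0) :+ con (+ 0)) := x :- :- x) refl x)

    *-bounded : ∀ y → ∃[ a ] (∀ {x} → - 1# < x → x < 1# → x * y ≤ a × - (x * y) ≤ a)
    *-bounded y with compare 0# y
    ... | tri< 0<y _ _ = y , λ -1<x x<1 →
          <⇒≤ (<-by (*-pos (x<y⇒0<y-x x<1) 0<y) (solve 2 (λ x y →
            (con (+ 1) :- x) :* y :- con (+ 0) := y :- x :* y) refl _ y))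
        , <⇒≤ (<-by (*-pos (x<y⇒0<y-x -1<x) 0<y) (solve 2 (λ x y →
            (x :- :- con (+ 1)) :* y :- con (+ 0) := y :- :- (x :* y)) refl _ y))
    ... | tri≈ _ 0≈y _ = 0# , λ _ _ →
          ≈⇒≤ (trans (*-congˡ (sym 0≈y)) (zeroʳ _))
        , ≈⇒≤ (trans (-‿cong (trans (*-congˡ (sym 0≈y)) (zeroʳ _))) -0#≈0#)
    ... | tri> _ _ y<0 = - y , λ -1<x x<1 →
          <⇒≤ (<-by (*-pos (x<y⇒0<y-x -1<x) (x<0⇒0<-x y<0)) (solve 2 (λ x y →
            (x :- :- con (+ 1)) :* :- y :- con (+ 0) := :- y :- x :* y) refl _ y))
        , <⇒≤ (<-by (*-pos (x<y⇒0<y-x x<1) (x<0⇒0<-x y<0)) (solve 2 (λ x y →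
            (con (+ 1) :- x) :* :- y :- con (+ 0) := :- y :- :- (x :* y)) refl _ y))

    Σ<-neg : ∀ g n → Σ< (-_ ∘ g) n ≈ - Σ< g n
    Σ<-neg g zero    = sym -0#≈0#
    Σ<-neg g (suc n) = trans (+-congʳ (Σ<-neg g n)) (-‿+-comm _ _)

    Σ<-≥ : ∀ {v} g → (∀ i → v ≤ g i) → ∀ n → n · v ≤ Σ< g n
    Σ<-≥ g v≤g zero    = ≈⇒≤ refl
    Σ<-≥ g v≤g (suc n) = ≤-by (Σ<-≥ g v≤g n ⟨≤+≤⟩ v≤g n)
      (solve 4 (λ a b v x → a :+ b :- (x :+ v) := a :+ b :- (v :+ x)) refl _ _ _ _)

    Σ<-unbounded : ∀ {v K} g → (∀ i → v ≤ g i) → (∀ n → Σ< g n ≤ K) → v ≤ 0#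
    Σ<-unbounded g v≤g Σ≤K 0<v =
      let n , _ , K<[1+n]v = floor (Σ≤K 0) 0<v in ≤-trans (Σ<-≥ g v≤g (suc n)) (Σ≤K (suc n)) K<[1+n]v

  -- Codings of exchanges of three intervals

  module Coding
    (ε l c : Carrier) (0<ε : 0# < ε) (ε<1 : ε < 1#) (ε<l : ε < l) (1-ε<l : 1# - ε < l)
    (l<1 : l < 1#) (-l<c : - l < c) (c≤0 : c ≤ 0#)
    (irrational : Irrational ε) (l∉ : ¬ (l ∈ℤ+ℤ ε))
    (u : InfiniteWord) (is3iet : IntervalExchange.Is3iet ε l c u) where

    open IntervalExchange ε l c
    open Rotation ε l c 0<ε ε<1 ε<l 1-ε<l l<1

    x : ℕ → Carrier
    x = fold 0# T

    opaque
      0<c+1 : 0# < c + 1#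
      0<c+1 = <-by (-l<c ⟨<+<⟩ l<1) (solve 2 (λ c l →
        c :+ con (+ 1) :- (:- l :+ l) := c :+ con (+ 1) :- con (+ 0)) refl c l)

      x∈I : ∀ n → I (u n) (x n)
      x∈I n = Equivalence.to (is3iet n (u n)) ≡.refl

      piece-x : ∀ n → piece (x n) ≡ u n
      piece-x n = I⇒piece (u n) (x∈I n)

      q<c+l : q < c + l
      q<c+l = <-by ε<l (solve 3 (λ c ε l → l :- ε := c :+ l :- (c :+ ε)) refl c ε l)

      I-bounds : ∀ X {y} → I X y → c ≤ y × y < c + l
      I-bounds A (c≤y , y<p) = c≤y , <-trans y<p (<-trans p<q q<c+l)
      I-bounds B (p≤y , y<q) = <⇒≤ (<-≤-trans c<p p≤y) , <-trans y<q q<c+l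
      I-bounds C (q≤y , y<c+l) = <⇒≤ (<-≤-trans (<-trans c<p p<q) q≤y) , y<c+l

      x-bounds : ∀ n → - 1# < x n × x n < 1#
      x-bounds n = let c≤x , x<c+l = I-bounds (u n) (x∈I n) in
          <-by (-l<c ⟨<+≤⟩ c≤x ⟨<+<⟩ l<1) (solve 3 (λ c x l →
            c :+ x :+ con (+ 1) :- (:- l :+ c :+ l) := x :- :- con (+ 1)) refl c (x n) l)
        , <-by (x<c+l ⟨<+≤⟩ c≤0 ⟨<+<⟩ l<1) (solve 3 (λ c x l →
            c :+ l :+ con (+ 0) :+ con (+ 1) :- (x :+ c :+ l) := con (+ 1) :- x) refl c (x n) l)

      x≈Σ : ∀ n → x n ≈ Σ< (shift ∘ u) n
      x≈Σ zero    = refl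
      x≈Σ (suc n) = +-cong (x≈Σ n) (reflexive (≡.cong shift (piece-x n)))

    module _ (s : Letter → Carrier)
      (f-bounds : ∀ n → - 1# < Σ< (s ∘ u) n × Σ< (s ∘ u) n < 1#) where

      f : ℕ → Carrier
      f = Σ< (s ∘ u)

      -- Weights for the rotation that reproduce `s` on the exchange: a visit to `I B` is followed
      -- by a second step, coded C, so w B + w C has to be s B. Equality of w A and w B then means s
      -- B = s A + s C.
      w : Letter → Carrier
      w A = s A
      w B = s B - s C
      w C = s C

      -- The 3iet is the first return map of the rotation to [ c , c + l ⟩; points of
      -- I B return after two steps, the others after one.
      data Visit (k : ℕ) : Set where
        at-base   : ∀ n → (R^ k) 0# ≈ x n → sum-along w 0# k ≈ f n → Visit k
        in-excess : ∀ n → u n ≡ B → (R^ k) 0# ≈ x n + (1# - ε) → sum-along w 0# k ≈ f n + (s B - s C) → Visit k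

      opaque
        visits : ∀ k → Visit k
        visits zero    = at-base 0 refl refl
        visits (suc k) with visits k
        ... | in-excess n un≡B r≈ F≈ = at-base (suc n)
            (begin
              R ((R^ k) 0#)               ≈⟨ R-cong r≈ ⟩
              R (x n + (1# - ε))          ≈⟨ R-high q≤r ⟩
              x n + (1# - ε) - ε          ≈⟨ solve 2 (λ x ε → x :+ (con (+ 1) :- ε) :- ε := x :+ (con (+ 1) :- (ε :+ ε))) refl (x n) ε ⟩
              x n + shift B               ≡⟨ ≡.cong (λ X → x n + shift X) (≡.sym (≡.trans (piece-x n) un≡B)) ⟩
              T (x n)                     ∎)
            (begin
              sum-along w 0# k + w (piece ((R^ k) 0#))   ≈⟨ +-cong F≈ (reflexive (≡.cong w (≡.trans (piece-cong r≈) (piece-C q≤r)))) ⟩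
              f n + (s B - s C) + s C                    ≈⟨ solve 3 (λ f b c → f :+ (b :- c) :+ c := f :+ b) refl (f n) (s B) (s C) ⟩
              f n + s B                                  ≡⟨ ≡.cong (λ X → f n + s X) (≡.sym un≡B) ⟩
              f (suc n)                                  ∎)
          where
          p≤x : p ≤ x n
          p≤x = proj₁ (≡.subst (λ X → I X (x n)) un≡B (x∈I n))

          -- The rotation takes `I B` onto `[ c + l , c + 1 ⟩`, which lies beyond `q` as ε < l;
          -- hence the second step is coded C.
          q≤r : q ≤ x n + (1# - ε)
          q≤r = ≤-by (p≤x ⟨≤+≤⟩ <⇒≤ ε<l) (solve 4 (λ c ε l x →
            x :+ l :- (c :+ ε :+ l :- con (+ 1) :+ ε) := x :+ (con (+ 1) :- ε) :- (c :+ ε)) refl c ε l (x n))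
        ... | at-base n r≈ F≈ = next (u n) ≡.refl
          where
          piece-r : piece ((R^ k) 0#) ≡ u n
          piece-r = ≡.trans (piece-cong r≈) (piece-x n)

          r-next : ∀ {X} → u n ≡ X → R ((R^ k) 0#) ≈ x n + rotation X
          r-next eq = +-cong r≈ (reflexive (≡.cong rotation (≡.trans piece-r eq)))

          F-next : ∀ {X} → u n ≡ X → sum-along w 0# (suc k) ≈ f n + w X
          F-next eq = +-cong F≈ (reflexive (≡.cong w (≡.trans piece-r eq)))

          x-next : ∀ {X} → u n ≡ X → x n + shift X ≈ x (suc n)
          x-next eq = +-congˡ (reflexive (≡.cong shift (≡.sym (≡.trans (piece-x n) eq))))

          f-next : ∀ {X} → u n ≡ X → f n + s X ≈ f (suc n)
          f-next eq = +-congˡ (reflexive (≡.cong s (≡.sym eq)))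

          next : ∀ X → u n ≡ X → Visit (suc k)
          next A eq = at-base (suc n) (trans (r-next eq) (x-next eq)) (trans (F-next eq) (f-next eq))
          next B eq = in-excess n eq (r-next eq) (F-next eq)
          next C eq = at-base (suc n) (trans (r-next eq) (x-next eq)) (trans (F-next eq) (f-next eq))

        -- Along the rotation the sums are values of `f`, up to one extra term s B - s C while the
        -- point is outside `[ c , c + l ⟩`.
        sum-bounded : ∃[ K ] (∀ k → sum-along w 0# k ≤ K × - sum-along w 0# k ≤ K)
        sum-bounded with absolute (s B - s C)
        ... | a , 0≤a , d≤a , -d≤a = 1# + a , λ k → bounded k (visits k)
          where
          -f≤1 : ∀ n → - f n ≤ 1#
          -f≤1 n = ≤-by (<⇒≤ (proj₁ (f-bounds n))) (solve 1 (λ f → f :- :- con (+ 1) := con (+ 1) :- :- f) refl (f n))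

          f≤1 : ∀ n → f n ≤ 1#
          f≤1 n = <⇒≤ (proj₂ (f-bounds n))

          bounded : ∀ k → Visit k → sum-along w 0# k ≤ 1# + a × - sum-along w 0# k ≤ 1# + a
          bounded k (at-base n _ F≈) =
              ≤-trans (≈⇒≤ (trans F≈ (sym (+-identityʳ _)))) (f≤1 n ⟨≤+≤⟩ 0≤a)
            , ≤-trans (≈⇒≤ (trans (-‿cong F≈) (sym (+-identityʳ _)))) (-f≤1 n ⟨≤+≤⟩ 0≤a)
          bounded k (in-excess n _ _ F≈) =
              ≤-trans (≈⇒≤ F≈) (f≤1 n ⟨≤+≤⟩ d≤a)
            , ≤-trans (≈⇒≤ (trans (-‿cong F≈) (sym (-‿+-comm _ _)))) (-f≤1 n ⟨≤+≤⟩ -d≤a)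

        sB-sC≈sA : s B - s C ≈ s A
        sB-sC≈sA = BoundedRemainder.bounded⇒no-jump ε l c 0<ε ε<1 ε<l 1-ε<l l<1 c≤0 0<c+1 irrational l∉
          w (proj₂ sum-bounded)

      -- The coefficients in s = λ t + κ (1, 2, 1): the shifts of A and C differ by 1, so λ is s A -
      -- s C, and the value at C then determines κ.
      slope κ : Carrier
      slope = s A - s C
      κ     = s C + ε * slope

      drift : Letter → Carrier
      drift A = κ
      drift B = κ + κ
      drift C = κ

      opaque
        s-affine : ∀ X → s X ≈ shift X * slope + drift X
        s-affine A = solve 3 (λ a c ε → a := (con (+ 1) :- ε) :* (a :- c) :+ (c :+ ε :* (a :- c))) refl (s A) (s C) ε
        s-affine B = begin
          s B                            ≈⟨ solve 2 (λ b c → b := b :- c :+ c) refl (s B) (s C) ⟩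
          s B - s C + s C                ≈⟨ +-congʳ sB-sC≈sA ⟩
          s A + s C                      ≈⟨ solve 3 (λ a c ε → a :+ c := (con (+ 1) :- (ε :+ ε)) :* (a :- c)
                                              :+ ((c :+ ε :* (a :- c)) :+ (c :+ ε :* (a :- c)))) refl (s A) (s C) ε ⟩
          shift B * slope + drift B      ∎
        s-affine C = solve 3 (λ a c ε → c := :- ε :* (a :- c) :+ (c :+ ε :* (a :- c))) refl (s A) (s C) ε

        f-affine : ∀ n → f n ≈ x n * slope + Σ< (drift ∘ u) n
        f-affine n = trans (go n) (+-congʳ (*-congʳ (sym (x≈Σ n))))
          where
          go : ∀ n → f n ≈ Σ< (shift ∘ u) n * slope + Σ< (drift ∘ u) n
          go zero    = solve 1 (λ s → con (+ 0) := con (+ 0) :* s :+ con (+ 0)) refl slope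
          go (suc n) = trans (+-cong (go n) (s-affine (u n)))
            (solve 5 (λ a b d e s → a :* s :+ b :+ (d :* s :+ e) := (a :+ d) :* s :+ (b :+ e)) refl _ _ _ _ _)

        drift-bounded : ∃[ K ] (∀ n → Σ< (drift ∘ u) n ≤ K × Σ< (-_ ∘ drift ∘ u) n ≤ K)
        drift-bounded with *-bounded slope
        ... | a , xs-bounded = 1# + a , λ n →
          let -1<x , x<1 = x-bounds n
              -1<f , f<1 = f-bounds n
              xs≤a , -xs≤a = xs-bounded -1<x x<1
          in ≤-by (<⇒≤ f<1 ⟨≤+≤⟩ -xs≤a) (begin
               1# + a - (f n + - (x n * slope))
                 ≈⟨ +-congˡ (-‿cong (+-congʳ (f-affine n))) ⟩
               1# + a - (x n * slope + Σ< (drift ∘ u) n + - (x n * slope))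
                 ≈⟨ solve 3 (λ a y d → a :- (y :+ d :+ :- y) := a :- d) refl (1# + a) (x n * slope) _ ⟩
               1# + a - Σ< (drift ∘ u) n
                 ∎)
           , ≤-by (<⇒≤ -1<f ⟨≤+≤⟩ xs≤a) (begin
               f n + a - (- 1# + x n * slope)
                 ≈⟨ +-congʳ (+-congʳ (f-affine n)) ⟩
               x n * slope + Σ< (drift ∘ u) n + a - (- 1# + x n * slope)
                 ≈⟨ solve 3 (λ a y d → y :+ d :+ a :- (:- con (+ 1) :+ y) := con (+ 1) :+ a :- :- d) refl a (x n * slope) _ ⟩
               1# + a - - Σ< (drift ∘ u) n
                 ≈⟨ +-congˡ (-‿cong (Σ<-neg (drift ∘ u) n)) ⟨
               1# + a - Σ< (-_ ∘ drift ∘ u) n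
                 ∎)

        -- Each drift is κ or 2κ, so if κ were nonzero the sums would grow at least linearly in one
        -- direction.
        κ≈0 : κ ≈ 0#
        κ≈0 with compare κ 0#
        ... | tri≈ _ κ≈0 _ = κ≈0
        ... | tri> _ _ 0<κ = ⊥-elim (Σ<-unbounded (drift ∘ u) (κ≤drift ∘ u) (proj₁ ∘ proj₂ drift-bounded) 0<κ)
          where
          κ≤drift : ∀ X → κ ≤ drift X
          κ≤drift A = ≈⇒≤ refl
          κ≤drift B = <⇒≤ (<-by 0<κ (solve 1 (λ k → k :- con (+ 0) := k :+ k :- k) refl κ))
          κ≤drift C = ≈⇒≤ refl
        ... | tri< κ<0 _ _ = ⊥-elim (Σ<-unbounded (-_ ∘ drift ∘ u) (-κ≤-drift ∘ u) (proj₂ ∘ proj₂ drift-bounded) (x<0⇒0<-x κ<0))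
          where
          -κ≤-drift : ∀ X → - κ ≤ - drift X
          -κ≤-drift A = ≈⇒≤ refl
          -κ≤-drift B = <⇒≤ (<-by κ<0 (solve 1 (λ k → con (+ 0) :- k := :- (k :+ k) :- :- k) refl κ))
          -κ≤-drift C = ≈⇒≤ refl

  opaque
    max-< : ∀ {x y z} → max x y < z → x < z × y < z
    max-< {x} {y} max<z with x <? y
    ... | yes x<y = <-trans x<y max<z , max<z
    ... | no  x≮y = max<z , ≤-<-trans x≮y max<z

    fromℤ-injective-0 : ∀ i → fromℤ i ≈ 0# → i ≡ + 0
    fromℤ-injective-0 (+ zero)  _  = ≡.refl
    fromℤ-injective-0 (+ suc n) eq = ⊥-elim (irrefl (sym eq) (<-respˡ (+-identityʳ 0#) (0<1 ⟨<+≤⟩ 0≤n·1 n)))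
    fromℤ-injective-0 -[1+ n ]  eq = ⊥-elim (irrefl
      (trans (sym -0#≈0#) (trans (-‿cong (sym eq)) (-‿involutive _)))
      (<-respˡ (+-identityʳ 0#) (0<1 ⟨<+≤⟩ 0≤n·1 n)))

    ·1-mono : ∀ {m n} → m ℕ.≤ n → m · 1# ≤ n · 1#
    ·1-mono {m} {n} m≤n = let k , m+k≡n = ℕ.m≤n⇒∃[o]m+o≡n m≤n in
      ≤-trans (≤-by (0≤n·1 k) (solve 2 (λ m k → k :- con (+ 0) := m :+ k :- m) refl (m · 1#) (k · 1#)))
              (≈⇒≤ (trans (sym (×-homo-+ 1# m k)) (reflexive (≡.cong (_· 1#) m+k≡n))))

  -- Sturm numbers

  module _ (poly : Quadratic) where
    open Quadratic poly

    private
      α β γ : Carrier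
      α = fromℤ a
      β = fromℤ b
      γ = fromℤ c

    opaque
      α≉0 : ¬ α ≈ 0#
      α≉0 = a≢0 ∘ fromℤ-injective-0 a

    module _ {x x′ : Carrier} (root : IsRoot poly x) (αx′ : α * x′ ≈ - β - α * x) where

      opaque
        -- The hypothesis `αx′` is Vieta's formula for the sum of the roots, freed of division.
        -- Substituting it twice turns the value at `x′` into the value at `x`.
        conjugate-root : IsRoot poly x′
        conjugate-root = begin
          α * (x′ * x′) + β * x′ + γ          ≈⟨ solve 4 (λ α β γ y → α :* (y :* y) :+ β :* y :+ γ := (α :* y) :* y :+ β :* y :+ γ) refl α β γ x′ ⟩
          (α * x′) * x′ + β * x′ + γ          ≈⟨ +-congʳ (+-congʳ (*-congʳ αx′)) ⟩
          (- β - α * x) * x′ + β * x′ + γ     ≈⟨ solve 5 (λ α β γ x y → (:- β :- α :* x) :* y :+ β :* y :+ γ := :- (α :* y) :* x :+ γ) refl α β γ x x′ ⟩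
          - (α * x′) * x + γ                  ≈⟨ +-congʳ (*-congʳ (-‿cong αx′)) ⟩
          - (- β - α * x) * x + γ             ≈⟨ solve 4 (λ α β γ x → :- (:- β :- α :* x) :* x :+ γ := α :* (x :* x) :+ β :* x :+ γ) refl α β γ x ⟩
          α * (x * x) + β * x + γ             ≈⟨ root ⟩
          0#                                  ∎

        -- A double root would be - b / (2a), which is rational.
        conjugate-distinct : Irrational x → ¬ x′ ≈ x
        conjugate-distinct irrational x′≈x = irrational (ℤ.- b , + 2 ℤ.* a , 2a≢0 , (begin
          fromℤ (+ 2 ℤ.* a) * x    ≈⟨ *-congʳ (fromℤ-* (+ 2) a) ⟩
          fromℤ (+ 2) * α * x      ≈⟨ solve 2 (λ α x → (con (+ 1) :+ (con (+ 1) :+ con (+ 0))) :* α :* x := α :* x :+ α :* x) refl α x ⟩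
          α * x + α * x            ≈⟨ +-congʳ (*-congˡ x′≈x) ⟨
          α * x′ + α * x           ≈⟨ +-congʳ αx′ ⟩
          - β - α * x + α * x      ≈⟨ solve 2 (λ b y → :- b :- y :+ y := :- b) refl β (α * x) ⟩
          - β                      ≈⟨ fromℤ-neg b ⟨
          fromℤ (ℤ.- b)            ∎))
          where
          2a≢0 : + 2 ℤ.* a ≢ + 0
          2a≢0 eq with ℤ.i*j≡0⇒i≡0∨j≡0 (+ 2) eq
          ... | inj₂ a≡0 = a≢0 a≡0

        product-of-roots : α * (x * x′) ≈ γ
        product-of-roots = begin
          α * (x * x′)                                 ≈⟨ solve 3 (λ α x y → α :* (x :* y) := (α :* y) :* x) refl α x x′ ⟩
          (α * x′) * x                                 ≈⟨ *-congʳ αx′ ⟩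
          (- β - α * x) * x                            ≈⟨ solve 4 (λ α β γ x → (:- β :- α :* x) :* x := γ :- (α :* (x :* x) :+ β :* x :+ γ)) refl α β γ x ⟩
          γ - (α * (x * x) + β * x + γ)                ≈⟨ +-congˡ (trans (-‿cong root) -0#≈0#) ⟩
          γ + 0#                                       ≈⟨ +-identityʳ γ ⟩
          γ                                            ∎

        value-at-1 : α * ((1# - x) * (1# - x′)) ≈ α + β + γ
        value-at-1 = begin
          α * ((1# - x) * (1# - x′))                   ≈⟨ solve 3 (λ α x y → α :* ((con (+ 1) :- x) :* (con (+ 1) :- y))
                                                           := α :- α :* x :- α :* y :+ α :* (x :* y)) refl α x x′ ⟩
          α - α * x - α * x′ + α * (x * x′)            ≈⟨ +-cong (+-congˡ (-‿cong αx′)) product-of-roots ⟩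
          α - α * x - (- β - α * x) + γ                ≈⟨ solve 4 (λ α β γ y → α :- y :- (:- β :- y) :+ γ := α :+ β :+ γ) refl α β γ (α * x) ⟩
          α + β + γ                                    ∎

        -- The values γ at 0 and α + β + γ at 1 would have the same sign if both roots
        -- were in ⟨0,1⟩.
        conjugate-outside : x ∈⟨0,1⟩ → γ ≤ 0# → 0# ≤ α + β + γ → ¬ x′ ∈⟨0,1⟩
        conjugate-outside (0<x , x<1) γ≤0 0≤sum (0<x′ , x′<1) with compare α 0#
        ... | tri≈ _ α≈0 _ = α≉0 α≈0
        ... | tri> _ _ 0<α = γ≤0 (<-respʳ product-of-roots (*-pos 0<α (*-pos 0<x 0<x′)))
        ... | tri< α<0 _ _ = 0≤sum (<-respˡ value-at-1 (<-by
          (*-pos (x<0⇒0<-x α<0) (*-pos (x<y⇒0<y-x x<1) (x<y⇒0<y-x x′<1)))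
          (solve 2 (λ α y → :- α :* y :- con (+ 0) := con (+ 0) :- α :* y) refl α _)))

    opaque
      sturm : ∀ {x} → Irrational x → x ∈⟨0,1⟩ → IsRoot poly x →
        γ ≤ 0# → 0# ≤ α + β + γ → SturmNumber x
      sturm {x} irrational x∈ root γ≤0 0≤sum with inverse α α≉0
      ... | i , αi≈1 =
          (irrational , poly , root) , x∈ , x′
        , (conjugate-distinct root αx′ irrational , poly , root , conjugate-root root αx′)
        , conjugate-outside root αx′ x∈ γ≤0 0≤sum
        where
        x′ : Carrier
        x′ = - (i * β) - x

        αx′ : α * x′ ≈ - β - α * x
        αx′ = begin
          α * (- (i * β) - x)          ≈⟨ solve 4 (λ α i β x → α :* (:- (i :* β) :- x) := :- ((α :* i) :* β) :- α :* x) refl α i β x ⟩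
          - ((α * i) * β) - α * x      ≈⟨ +-congʳ (-‿cong (trans (*-congʳ αi≈1) (*-identityˡ β))) ⟩
          - β - α * x                  ∎

  module _ (ε : Carrier) (irrational : Irrational ε) (ε∈ : ε ∈⟨0,1⟩) where

    opaque
      -- The hypothesis is κ = 0; expanded and negated it is a quadratic equation for ε whose
      -- polynomial takes the values - P_C at 0 and Q_A - P_A at 1.
      sturm-by-counts : ∀ P_A Q_A P_C Q_C → P_A ℕ.≤ Q_A → P_C ≢ 0 →
        let s_A = P_A · 1# - Q_A · ε
            s_C = P_C · 1# - Q_C · ε
        in s_C + ε * (s_A - s_C) ≈ 0# → SturmNumber ε
      sturm-by-counts P_A Q_A P_C Q_C P≤Q P_C≢0 eq =
        sturm (record { a = a ; b = b ; c = ℤ.- (+ P_C) ; a≢0 = a≢0 }) irrational ε∈ root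
          (≤-trans (≈⇒≤ (fromℤ-neg (+ P_C)))
                   (≤-by (0≤n·1 P_C) (solve 1 (λ x → x :- con (+ 0) := con (+ 0) :- :- x) refl (P_C · 1#))))
          (≤-by (·1-mono P≤Q) (begin
            Q_A · 1# - P_A · 1#
              ≈⟨ solve 4 (λ Pa Qa Pc Qc → Qa :- Pa := Qa :- Qc :+ (Qc :+ Pc :- Pa) :+ :- Pc :- con (+ 0))
                   refl (P_A · 1#) (Q_A · 1#) (P_C · 1#) (Q_C · 1#) ⟩
            Q_A · 1# - Q_C · 1# + (Q_C · 1# + P_C · 1# - P_A · 1#) + - (P_C · 1#) - 0#
              ≈⟨ +-congʳ (+-cong (+-cong (fromℤ-⊖ Q_A Q_C) b≈) (fromℤ-neg (+ P_C))) ⟨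
            fromℤ a + fromℤ b + fromℤ (ℤ.- (+ P_C)) - 0#
              ∎))
        where
        a b : ℤ
        a = Q_A ℤ.⊖ Q_C
        b = (Q_C ℕ.+ P_C) ℤ.⊖ P_A

        b≈ : fromℤ b ≈ Q_C · 1# + P_C · 1# - P_A · 1#
        b≈ = trans (fromℤ-⊖ (Q_C ℕ.+ P_C) P_A) (+-congʳ (×-homo-+ 1# Q_C P_C))

        root : fromℤ a * (ε * ε) + fromℤ b * ε + fromℤ (ℤ.- (+ P_C)) ≈ 0#
        root = begin
          fromℤ a * (ε * ε) + fromℤ b * ε + fromℤ (ℤ.- (+ P_C))
            ≈⟨ +-cong (+-cong (*-congʳ (fromℤ-⊖ Q_A Q_C)) (*-congʳ b≈)) (fromℤ-neg (+ P_C)) ⟩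
          (Q_A · 1# - Q_C · 1#) * (ε * ε) + (Q_C · 1# + P_C · 1# - P_A · 1#) * ε + - (P_C · 1#)
            ≈⟨ solve 5 (λ Pa Qa Pc Qc ε →
                 (Qa :- Qc) :* (ε :* ε) :+ (Qc :+ Pc :- Pa) :* ε :+ :- Pc :=
                 :- (Pc :- Qc :* ε :+ ε :* (Pa :- Qa :* ε :- (Pc :- Qc :* ε))))
                 refl (P_A · 1#) (Q_A · 1#) (P_C · 1#) (Q_C · 1#) ε ⟩
          - (P_C · 1# - Q_C · 1# * ε + ε * (P_A · 1# - Q_A · 1# * ε - (P_C · 1# - Q_C · 1# * ε)))
            ≈⟨ -‿cong (+-cong (+-congˡ (-‿cong (fromℤ-·1 Q_C ε)))
                 (*-congˡ (+-cong (+-congˡ (-‿cong (fromℤ-·1 Q_A ε)))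
                                  (-‿cong (+-congˡ (-‿cong (fromℤ-·1 Q_C ε))))))) ⟩
          - (P_C · 1# - Q_C · ε + ε * (P_A · 1# - Q_A · ε - (P_C · 1# - Q_C · ε)))
            ≈⟨ -‿cong eq ⟩
          - 0#
            ≈⟨ -0#≈0# ⟩
          0# ∎

        -- With a = 0 the equation reads b ε = P_C: for b nonzero ε would be rational, and b = 0
        -- would force P_C = 0.
        a≢0 : a ≢ + 0
        a≢0 a≡0 with b ℤ.≟ + 0
        ... | no b≢0 = irrational (+ P_C , b , b≢0 , linear)
          where
          linear : fromℤ b * ε ≈ P_C · 1#
          linear = begin
            fromℤ b * ε
              ≈⟨ solve 3 (λ e y z → y := con (+ 0) :* e :+ y :+ :- z :+ z) refl (ε * ε) (fromℤ b * ε) (P_C · 1#) ⟩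
            0# * (ε * ε) + fromℤ b * ε + - (P_C · 1#) + P_C · 1#
              ≈⟨ +-congʳ (+-cong (+-congʳ (*-congʳ (reflexive (≡.cong fromℤ a≡0)))) (fromℤ-neg (+ P_C))) ⟨
            fromℤ a * (ε * ε) + fromℤ b * ε + fromℤ (ℤ.- (+ P_C)) + P_C · 1#
              ≈⟨ +-congʳ root ⟩
            0# + P_C · 1#
              ≈⟨ +-identityˡ _ ⟩
            P_C · 1# ∎
        ... | yes b≡0 = P_C≢0 (ℤ.+-injective (fromℤ-injective-0 (+ P_C) (begin
            P_C · 1#
              ≈⟨ solve 3 (λ e f z → z := con (+ 0) :* e :+ con (+ 0) :* f :- (con (+ 0) :* e :+ con (+ 0) :* f :+ :- z)) refl (ε * ε) ε (P_C · 1#) ⟩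
            0# * (ε * ε) + 0# * ε - (0# * (ε * ε) + 0# * ε + - (P_C · 1#))
              ≈⟨ +-congˡ (-‿cong (+-cong (+-cong (*-congʳ (reflexive (≡.cong fromℤ a≡0))) (*-congʳ (reflexive (≡.cong fromℤ b≡0)))) (fromℤ-neg (+ P_C)))) ⟨
            0# * (ε * ε) + 0# * ε - (fromℤ a * (ε * ε) + fromℤ b * ε + fromℤ (ℤ.- (+ P_C)))
              ≈⟨ +-congˡ (-‿cong root) ⟩
            0# * (ε * ε) + 0# * ε - 0#
              ≈⟨ solve 2 (λ e f → con (+ 0) :* e :+ con (+ 0) :* f :- con (+ 0) := con (+ 0)) refl (ε * ε) ε ⟩
            0# ∎)))

  -- Letter counts and the substitution fixing the word.

  -- A word moves a point by P - Q ε, whence B counts once in `P` and twice in `Q`.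
  P Q : List Letter → ℕ
  P []       = 0
  P (A ∷ xs) = suc (P xs)
  P (B ∷ xs) = suc (P xs)
  P (C ∷ xs) = P xs
  Q []       = 0
  Q (A ∷ xs) = suc (Q xs)
  Q (B ∷ xs) = suc (suc (Q xs))
  Q (C ∷ xs) = suc (Q xs)

  opaque
    P≤Q : ∀ xs → P xs ℕ.≤ Q xs
    P≤Q []       = ℕ.z≤n
    P≤Q (A ∷ xs) = ℕ.s≤s (P≤Q xs)
    P≤Q (B ∷ xs) = ℕ.s≤s (ℕ.m≤n⇒m≤1+n (P≤Q xs))
    P≤Q (C ∷ xs) = ℕ.m≤n⇒m≤1+n (P≤Q xs)

    P≡0⇒only-C : ∀ xs → P xs ≡ 0 → ∣ xs ∣[ A ] ≡ 0 × ∣ xs ∣[ B ] ≡ 0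
    P≡0⇒only-C []       _  = ≡.refl , ≡.refl
    P≡0⇒only-C (C ∷ xs) eq = P≡0⇒only-C xs eq

    -- The image of C is then a power of C, and so are its iterated images, which keeps the entry
    -- (C, A) of every power of the matrix at 0.
    not-primitive : ∀ φ → incidence φ C A ≡ 0 → incidence φ C B ≡ 0 → ¬ Primitive φ
    not-primitive φ CA≡0 CB≡0 (k , positive) = ℕ.<-irrefl (≡.sym (C-invariant k)) (positive C A)
      where
      C-invariant : ∀ k → power (incidence φ) k C A ≡ 0
      C-invariant zero    = ≡.refl
      C-invariant (suc k) rewrite CA≡0 | CB≡0 | C-invariant k | ℕ.*-zeroʳ (incidence φ C C) = ≡.refl

    total-shift : ∀ ε l c xs → total (IntervalExchange.shift ε l c) xs ≈ P xs · 1# - Q xs · ε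
    total-shift ε l c []       = solve 0 (con (+ 0) := con (+ 0) :- con (+ 0)) refl
    total-shift ε l c (A ∷ xs) = trans (+-congˡ (total-shift ε l c xs))
      (solve 3 (λ ε p q → con (+ 1) :- ε :+ (p :- q) := con (+ 1) :+ p :- (ε :+ q)) refl ε _ _)
    total-shift ε l c (B ∷ xs) = trans (+-congˡ (total-shift ε l c xs))
      (solve 3 (λ ε p q → con (+ 1) :- (ε :+ ε) :+ (p :- q) := con (+ 1) :+ p :- (ε :+ (ε :+ q))) refl ε _ _)
    total-shift ε l c (C ∷ xs) = trans (+-congˡ (total-shift ε l c xs))
      (solve 3 (λ ε p q → :- ε :+ (p :- q) := p :- (ε :+ q)) refl ε _ _)

  3iet-fixed-point⇒sturm :
    (ε l c : Carrier) → 0# < ε → ε < 1# → max ε (1# - ε) < l → l < 1# → - l < c → c ≤ 0# →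
    Irrational ε → ¬ (l ∈ℤ+ℤ ε) →
    (u : InfiniteWord) → IntervalExchange.Is3iet ε l c u →
    (φ : Substitution) → Primitive φ → (φ $∞ u) ≗ u → SturmNumber ε
  3iet-fixed-point⇒sturm ε l c 0<ε ε<1 max<l l<1 -l<c c≤0 irrational l∉ u is3iet φ φ-primitive fixed =
    sturm-by-counts ε irrational (0<ε , ε<1)
      (P ⟦ [ A ] ⟧) (Q ⟦ [ A ] ⟧) (P ⟦ [ C ] ⟧) (Q ⟦ [ C ] ⟧) (P≤Q ⟦ [ A ] ⟧)
      (λ P≡0 → let CA≡0 , CB≡0 = P≡0⇒only-C ⟦ [ C ] ⟧ P≡0 in not-primitive φ CA≡0 CB≡0 φ-primitive)
      (begin
        s′ C + ε * (s′ A - s′ C)  ≈⟨ +-cong (s≈ C) (*-congˡ (+-cong (s≈ A) (-‿cong (s≈ C)))) ⟨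
        s C + ε * (s A - s C)     ≈⟨ κ≈0 s s-bounds ⟩
        0#                        ∎)
    where
    open Substitution φ
    open IntervalExchange ε l c
    open Coding ε l c 0<ε ε<1 (proj₁ (max-< max<l)) (proj₂ (max-< max<l)) l<1 -l<c c≤0 irrational l∉ u is3iet

    s s′ : Letter → Carrier
    s X  = total shift ⟦ [ X ] ⟧
    s′ X = P ⟦ [ X ] ⟧ · 1# - Q ⟦ [ X ] ⟧ · ε

    s≈ : ∀ X → s X ≈ s′ X
    s≈ X = total-shift ε l c ⟦ [ X ] ⟧

    -- As φ fixes `u`, a sum of `s` over a prefix of `u` is a sum of shifts over a longer or equal
    -- prefix, that is, a point `x N` of the orbit of 0.
    s-bounds : ∀ n → - 1# < Σ< (s ∘ u) n × Σ< (s ∘ u) n < 1#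
    s-bounds n = <-respʳ x≈ (proj₁ (x-bounds N)) , <-respˡ x≈ (proj₂ (x-bounds N))
      where
      W : ℕ → List⁺ Letter
      W i = toList⁺ ⟦ [ u i ] ⟧ (nonErasing (u i))

      N : ℕ
      N = proj₁ (Σ<-concat∞ shift W n)

      x≈ : x N ≈ Σ< (s ∘ u) n
      x≈ = begin
        x N                                          ≈⟨ x≈Σ N ⟩
        Σ< (shift ∘ u) N                             ≈⟨ Σ<-cong (λ i → reflexive (≡.cong shift (fixed i))) N ⟨
        Σ< (shift ∘ concat∞ W) N                     ≈⟨ proj₂ (Σ<-concat∞ shift W n) ⟩
        Σ< (λ i → total shift (toList (W i))) n      ≈⟨ Σ<-cong (λ i → reflexive (≡.cong (total shift)
                                                          (toList-toList⁺ ⟦ [ u i ] ⟧ (nonErasing (u i))))) n ⟩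
        Σ< (s ∘ u) n                                 ∎

theoremB : (ℝ : CompleteOrderedField) →
    let open Reals ℝ in
    (ε l c : Carrier) →
    0# < ε → ε < 1# →
    max ε (1# - ε) < l → l < 1# →
    - l < c → c ≤ 0# →
    Irrational ε →
    ¬ (l ∈ℤ+ℤ ε) →
    (u : InfiniteWord) → IntervalExchange.Is3iet ε l c u →
    (φ : Substitution) → Primitive φ →
    (φ $∞ u) ≗ u →
    SturmNumber ε
theoremB = 3iet-fixed-point⇒sturm
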